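{- Let $k\geq 3$ and $a,b,c$ be integers with $1<a<b<c$ and $a^k<b<c$. Then $\{a^k,b,c\}$ is not a $k$-th power Diophantine triple; that is, it is not the case that all three of $a^kb+1$, $a^kc+1$ and $bc+1$ are perfect $k$-th powers of integers.
   Context: For an integer $k\geq 3$, a $k$-th power Diophantine triple is a set of three positive integers $\{x_1,x_2,x_3\}$ such that $x_ix_j+1$ is a perfect $k$-th power of an integer for all $1\leq i<j\leq 3$. -}

module Defs where

open import Data.Nat using (ℕ)
open import Data.Integer using (ℤ; +_) renaming (_^_ to _^ℤ_)
open import Data.Product using (∃-syntax)
open import Relation.Binary.PropositionalEquality using (_≡_)

IsKthPower : ℕ → ℕ → Set
IsKthPower k n = ∃[ y ] (y ^ℤ k ≡ + n)

{-# OPTIONS --safe #-}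
module Submission where

-- Put X = xᵏ = aᵏb + 1, Y = X - 1, q = xy, p = a²z.  Then pᵏ lies just below yᵏY while
-- qᵏ = yᵏX, so p / q is an extremely good approximation to θ = (Y / X)^(1/k) from below.
-- The diagonal Padé approximants A / B of the k-th root (the hypergeometric method of Thue and
-- Siegel) approximate θ from above, hence N = q A(X,Y) - p B(X,Y) is positive.  Since n! divides
-- kⁿ⁻¹N, this excludes y from a whole range, for every n ≥ 1.  Because k ≥ 3, consecutive ranges
-- overlap and, together with an elementary gap principle for small y, they leave no y at all.
--
-- No real numbers are needed: θ is replaced by rational points v / u, at which the linear form
-- L = u A(uᵏ,vᵏ) - v B(uᵏ,vᵏ) satisfies ∂²Lₙ/∂u² = Cₙ uᵏ⁻² Lₙ₋₁ with Lₙ = ∂Lₙ/∂u = 0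
-- at u = v for n ≥ 1.  Comparing power series in d = u - v term by term then gives both L > 0 and an upper bound
-- of order d²ⁿ⁺¹.

-- The forms are controlled only at arguments `(uᵏ , vᵏ)`, while `N` lives at `(X , Y)`. The bridge
-- is homogeneity together with the monotonicity of `A / B` in its second argument, so that a
-- rational point on the right side of θ yields an inequality at θ. Positivity of `N` uses `p / q`,
-- below θ; the upper bound uses `v / u = (p M + δ) / (q M)` with `M = k pᵏ⁻¹`, just above θ.
--
-- The upper bound for `N` has a part proportional to δ and the Padé error. Once `yᵏ⁻¹` exceeds
-- roughly `(4 k² X)ⁿ`, the δ-part is at most a quarter of what `n ! ≤ kⁿ⁻¹ N` demands, and the
-- error must supply the rest; this forces `q ≥ (3/4) k² Y (4 Y² / (k² X))ⁿ`. So the start of the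
-- range grows by `4 k² X` per step, measured in `yᵏ⁻¹`, and its end by `4 Y² / (k² X)`, measured in
-- `y`. Overlap requires `4 k² X ≤ (4 Y² / (k² X))ⁱ` for some `i ≤ k - 1`. This is false for
-- `i = 1`, whatever `X` is, and true for `i = 2` or `3` when `X` is large enough compared with `k`.

open import Defs
open import Data.Empty using (⊥)
import Data.Integer as ℤ
import Data.Integer.Properties as ℤ
open import Data.Nat
open import Data.Nat.Combinatorics using (nCn≡1; nCk+nC[k+1]≡[n+1]C[k+1]) renaming (_C_ to _choose_)
open import Data.Nat.Divisibility
open import Data.Nat.Properties
open import Data.Nat.Tactic.RingSolver using (solve-∀)
open import Data.Product using (_×_; _,_; ∃-syntax; proj₁; proj₂)
open import Data.Unit using (tt)
open import Function using (_∘_)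
open import Relation.Binary.PropositionalEquality
  using (_≡_; refl; sym; trans; cong; cong₂; subst; subst₂; module ≡-Reasoning)
open import Relation.Nullary using (¬_; yes; no)

-- Antidiagonal sums, rising factorials and their Vandermonde identities

-- The sum of F l m over l + m ≡ n.
S : (ℕ → ℕ → ℕ) → ℕ → ℕ
S F zero    = F 0 0
S F (suc n) = F 0 (suc n) + S (F ∘ suc) n

S-cong : ∀ {F G} n → (∀ l m → l + m ≡ n → F l m ≡ G l m) → S F n ≡ S G n
S-cong zero    eq = eq 0 0 refl
S-cong (suc n) eq = cong₂ _+_ (eq 0 (suc n) refl) (S-cong n (λ l m p → eq (suc l) m (cong suc p)))

S-mono : ∀ {F G} n → (∀ l m → l + m ≡ n → F l m ≤ G l m) → S F n ≤ S G n
S-mono zero    le = le 0 0 refl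
S-mono (suc n) le = +-mono-≤ (le 0 (suc n) refl) (S-mono n (λ l m p → le (suc l) m (cong suc p)))

S-+ : ∀ F G n → S (λ l m → F l m + G l m) n ≡ S F n + S G n
S-+ F G zero    = refl
S-+ F G (suc n) = trans (cong (F 0 (suc n) + G 0 (suc n) +_) (S-+ (F ∘ suc) (G ∘ suc) n)) (lem (F 0 (suc n)) (G 0 (suc n)) _ _)
  where
  lem : ∀ a b c d → a + b + (c + d) ≡ a + c + (b + d)
  lem = solve-∀

S-* : ∀ c F n → S (λ l m → c * F l m) n ≡ c * S F n
S-* c F zero    = refl
S-* c F (suc n) = trans (cong (c * F 0 (suc n) +_) (S-* c (F ∘ suc) n)) (sym (*-distribˡ-+ c _ _))

S-last : ∀ F n → S F (suc n) ≡ S (λ l m → F l (suc m)) n + F (suc n) 0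
S-last F zero    = refl
S-last F (suc n) = trans (cong (F 0 (suc (suc n)) +_) (S-last (F ∘ suc) n)) (sym (+-assoc (F 0 (suc (suc n))) _ _))

-- Indexing by the two parts of the antidiagonal keeps subtraction out of all coefficients.
bin : ℕ → ℕ → ℕ
bin l m = (l + m) choose l

bin-zeroʳ : ∀ l → bin l 0 ≡ 1
bin-zeroʳ l rewrite +-identityʳ l = nCn≡1 l

bin-pascal : ∀ l m → bin (suc l) (suc m) ≡ bin l (suc m) + bin (suc l) m
bin-pascal l m = trans (sym (nCk+nC[k+1]≡[n+1]C[k+1] (l + suc m) l))
  (cong (λ n → (l + suc m) choose l + n choose suc l) (+-suc l m))

-- Summation by parts with Pascal's rule: interior binomials split in two, and the two at the ends
-- are 1. It drives the induction on `n` in both Vandermonde identities.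
bin-pascal-sum : ∀ (X : ℕ → ℕ → ℕ) n → S (λ l m → bin l m * X l m) (suc n) ≡
  S (λ l m → bin l m * (X (suc l) m + X l (suc m))) n
bin-pascal-sum X zero = base (X 1 0) (X 0 1)
  where
  base : ∀ x y → 1 * y + 1 * x ≡ 1 * (x + y)
  base = solve-∀
bin-pascal-sum X (suc n) = begin
  x₀ + S (λ l m → bin (suc l) m * X (suc l) m) (suc n)
    ≡⟨ cong (x₀ +_) (S-last (λ l m → bin (suc l) m * X (suc l) m) n) ⟩
  x₀ + (S (λ l m → bin (suc l) (suc m) * X (suc l) (suc m)) n + bin (suc (suc n)) 0 * xₙ)
    ≡⟨ cong₂ (λ s b → x₀ + (s + b * xₙ))
         (trans (S-cong n (λ l m _ → trans (cong (_* X (suc l) (suc m)) (bin-pascal l m)) (*-distribʳ-+ _ (bin l (suc m)) _)))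
                (S-+ (λ l m → bin l (suc m) * X (suc l) (suc m)) (λ l m → bin (suc l) m * X (suc l) (suc m)) n))
         (trans (bin-zeroʳ (suc (suc n))) (sym (bin-zeroʳ (suc n)))) ⟩
  x₀ + (s₁ + s₂ + bin (suc n) 0 * xₙ)
    ≡⟨ lem x₀ s₁ s₂ (bin (suc n) 0 * xₙ) ⟩
  (s₁ + bin (suc n) 0 * xₙ) + (x₀ + s₂)
    ≡⟨ cong (_+ (x₀ + s₂)) (S-last (λ l m → bin l m * X (suc l) m) n) ⟨
  S (λ l m → bin l m * X (suc l) m) (suc n) + S (λ l m → bin l m * X l (suc m)) (suc n)
    ≡⟨ S-+ (λ l m → bin l m * X (suc l) m) (λ l m → bin l m * X l (suc m)) (suc n) ⟨
  S (λ l m → bin l m * X (suc l) m + bin l m * X l (suc m)) (suc n)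
    ≡⟨ S-cong (suc n) (λ l m _ → *-distribˡ-+ (bin l m) (X (suc l) m) (X l (suc m))) ⟨
  S (λ l m → bin l m * (X (suc l) m + X l (suc m))) (suc n) ∎
  where
  open ≡-Reasoning
  x₀ xₙ s₁ s₂ : ℕ
  x₀ = bin 0 (suc (suc n)) * X 0 (suc (suc n))
  xₙ = X (suc (suc n)) 0
  s₁ = S (λ l m → bin l (suc m) * X (suc l) (suc m)) n
  s₂ = S (λ l m → bin (suc l) m * X (suc l) (suc m)) n
  lem : ∀ a b c d → a + (b + c + d) ≡ (b + d) + (a + c)
  lem = solve-∀

bin-! : ∀ l m → bin l m * (l ! * m !) ≡ (l + m) !
bin-! zero    m = lem (m !)
  where
  lem : ∀ x → 1 * (1 * x) ≡ x
  lem = solve-∀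
bin-! (suc l) zero = trans (cong₂ _*_ (bin-zeroʳ (suc l)) (*-identityʳ (suc l !)))
  (trans (*-identityˡ (suc l !)) (cong (λ x → suc x !) (sym (+-identityʳ l))))
bin-! (suc l) (suc m) = begin
  bin (suc l) (suc m) * (suc l ! * suc m !)
    ≡⟨ cong (_* (suc l ! * suc m !)) (bin-pascal l m) ⟩
  (bin l (suc m) + bin (suc l) m) * (suc l ! * suc m !)
    ≡⟨ lem (suc l) (suc m) (l !) (m !) (bin l (suc m)) (bin (suc l) m) ⟩
  suc l * (bin l (suc m) * (l ! * suc m !)) + suc m * (bin (suc l) m * (suc l ! * m !))
    ≡⟨ cong₂ (λ x y → suc l * x + suc m * y) (bin-! l (suc m)) (trans (bin-! (suc l) m) (cong _! (sym (+-suc l m)))) ⟩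
  suc l * (l + suc m) ! + suc m * (l + suc m) !
    ≡⟨ *-distribʳ-+ ((l + suc m) !) (suc l) (suc m) ⟨
  (suc l + suc m) ! ∎
  where
  open ≡-Reasoning
  lem : ∀ L M x y b c → (b + c) * ((L * x) * (M * y)) ≡ L * (b * (x * (M * y))) + M * (c * ((L * x) * y))
  lem = solve-∀

bin-suc : ∀ l m → suc l * bin (suc l) m ≡ suc (l + m) * bin l m
bin-suc l m = *-cancelʳ-≡ _ _ (l ! * m !) {{l !* m !≢0}} (begin
  suc l * bin (suc l) m * (l ! * m !)   ≡⟨ lem (suc l) (bin (suc l) m) (l !) (m !) ⟩
  bin (suc l) m * (suc l ! * m !)       ≡⟨ bin-! (suc l) m ⟩
  suc (l + m) * (l + m) !               ≡⟨ cong (suc (l + m) *_) (bin-! l m) ⟨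
  suc (l + m) * (bin l m * (l ! * m !)) ≡⟨ *-assoc (suc (l + m)) (bin l m) _ ⟨
  suc (l + m) * bin l m * (l ! * m !)   ∎)
  where
  open ≡-Reasoning
  lem : ∀ L b x y → L * b * (x * y) ≡ b * (L * x * y)
  lem = solve-∀

-- R k j x = x (x + k) ⋯ (x + (j - 1) k)
R : ℕ → ℕ → ℕ → ℕ
R k zero    x = 1
R k (suc j) x = x * R k j (x + k)

R-+ : ∀ k i j x → R k (i + j) x ≡ R k i x * R k j (x + i * k)
R-+ k zero    j x = trans (cong (R k j) (sym (+-identityʳ x))) (sym (*-identityˡ _))
R-+ k (suc i) j x = trans (cong (x *_) (R-+ k i j (x + k)))
  (trans (sym (*-assoc x _ _)) (cong (λ y → x * R k i (x + k) * R k j y) (+-assoc x k (i * k))))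

R-suc : ∀ k j x → R k (suc j) x ≡ R k j x * (x + j * k)
R-suc k j x = trans (cong (λ i → R k i x) (+-comm 1 j)) (trans (R-+ k j 1 x) (cong (R k j x *_) (*-identityʳ _)))

R-mono : ∀ k j {x y} → x ≤ y → R k j x ≤ R k j y
R-mono k zero    x≤y = ≤-refl
R-mono k (suc j) x≤y = *-mono-≤ x≤y (R-mono k j (+-monoˡ-≤ k x≤y))

R-pos : ∀ k j {x} → 0 < x → 0 < R k j x
R-pos k zero    0<x = ≤-refl
R-pos k (suc j) 0<x = *-mono-≤ 0<x (R-pos k j (≤-trans 0<x (m≤m+n _ k)))

R-pred : ∀ k n x → R k n (x + k + pred n * k) ≡ R k n (x + n * k)
R-pred k zero    x = refl
R-pred k (suc n) x = cong (R k (suc n)) (+-assoc x k (n * k))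

-- The coefficient of Uˡ Vᵐ in A for (s , t) = (k + 1 , k - 1), in B for (s , t) = (k - 1 , k + 1).
coef : ℕ → ℕ → ℕ → ℕ → ℕ → ℕ
coef k s t l m = bin l m * (R k m (s + l * k) * R k l (t + m * k))

-- After `bin-pascal-sum` the last factors of the longer products are `t + n k` and `s + n k`; they
-- no longer depend on `l` and come out of the sum. The two sums that remain have shifted parameters
-- with the same total `s + t + k`, so by induction they coincide. The truncated `pred 0` is
-- harmless because the product is then empty.
coef-sum : ∀ k n s t → S (coef k s t) n ≡ R k n (s + t + pred n * k)
coef-sum k zero    s t = refl
coef-sum k (suc n) s t = begin
  S (coef k s t) (suc n)
    ≡⟨ bin-pascal-sum (λ l m → R k m (s + l * k) * R k l (t + m * k)) n ⟩
  S (λ l m → bin l m * (R k m (s + suc l * k) * R k (suc l) (t + m * k) + R k (suc m) (s + l * k) * R k l (t + suc m * k))) n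
    ≡⟨ S-cong n step ⟩
  S (λ l m → (t + n * k) * coef k (s + k) t l m + (s + n * k) * coef k s (t + k) l m) n
    ≡⟨ trans (S-+ (λ l m → (t + n * k) * coef k (s + k) t l m) (λ l m → (s + n * k) * coef k s (t + k) l m) n)
         (cong₂ _+_ (S-* (t + n * k) (coef k (s + k) t) n) (S-* (s + n * k) (coef k s (t + k)) n)) ⟩
  (t + n * k) * S (coef k (s + k) t) n + (s + n * k) * S (coef k s (t + k)) n
    ≡⟨ cong₂ (λ x y → (t + n * k) * x + (s + n * k) * y)
         (trans (coef-sum k n (s + k) t) (trans (cong (λ x → R k n (x + pred n * k)) (lem₁ s t k)) (R-pred k n (s + t))))
         (trans (coef-sum k n s (t + k)) (trans (cong (λ x → R k n (x + pred n * k)) (lem₂ s t k)) (R-pred k n (s + t)))) ⟩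
  (t + n * k) * r + (s + n * k) * r ≡⟨ lem₃ s t (n * k) r ⟩
  r * (s + t + n * k + n * k)       ≡⟨ R-suc k n (s + t + n * k) ⟨
  R k (suc n) (s + t + n * k)       ∎
  where
  open ≡-Reasoning
  r : ℕ
  r = R k n (s + t + n * k)
  lem₁ : ∀ s t k → s + k + t ≡ s + t + k
  lem₁ = solve-∀
  lem₂ : ∀ s t k → s + (t + k) ≡ s + t + k
  lem₂ = solve-∀
  lem₃ : ∀ s t x r → (t + x) * r + (s + x) * r ≡ r * (s + t + x + x)
  lem₃ = solve-∀
  arg : ∀ a l m → l + m ≡ n → a + l * k + m * k ≡ a + n * k
  arg a l m refl = lem a l m k
    where
    lem : ∀ a l m k → a + l * k + m * k ≡ a + (l + m) * k
    lem = solve-∀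
  arg′ : ∀ a l m → l + m ≡ n → a + m * k + l * k ≡ a + n * k
  arg′ a l m refl = lem a l m k
    where
    lem : ∀ a l m k → a + m * k + l * k ≡ a + (l + m) * k
    lem = solve-∀
  step : ∀ l m → l + m ≡ n → _
  step l m p = begin
    bin l m * (R k m (s + suc l * k) * R k (suc l) (t + m * k) + R k (suc m) (s + l * k) * R k l (t + suc m * k))
      ≡⟨ cong₂ (λ x y → bin l m * (R k m (s + suc l * k) * x + y * R k l (t + suc m * k)))
           (trans (R-suc k l (t + m * k)) (cong (R k l (t + m * k) *_) (arg′ t l m p)))
           (trans (R-suc k m (s + l * k)) (cong (R k m (s + l * k) *_) (arg s l m p))) ⟩
    bin l m * (R k m (s + suc l * k) * (R k l (t + m * k) * (t + n * k)) + R k m (s + l * k) * (s + n * k) * R k l (t + suc m * k))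
      ≡⟨ cong₂ (λ x y → bin l m * (R k m x * (R k l (t + m * k) * (t + n * k)) + R k m (s + l * k) * (s + n * k) * R k l y))
           (sym (+-assoc s k (l * k))) (sym (+-assoc t k (m * k))) ⟩
    bin l m * (R k m (s + k + l * k) * (R k l (t + m * k) * (t + n * k)) + R k m (s + l * k) * (s + n * k) * R k l (t + k + m * k))
      ≡⟨ lem (bin l m) (R k m (s + k + l * k)) (R k l (t + m * k)) (t + n * k) (R k m (s + l * k)) (s + n * k) (R k l (t + k + m * k)) ⟩
    (t + n * k) * coef k (s + k) t l m + (s + n * k) * coef k s (t + k) l m ∎
    where
    lem : ∀ b p q u v w z → b * (p * (q * u) + v * w * z) ≡ u * (b * (p * q)) + w * (b * (v * z))
    lem = solve-∀

-- The recurrence behind ∂²Lₙ/∂u² = Cₙ uᵏ⁻² Lₙ₋₁.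
coef-suc : ∀ k s t l m →
  suc l * (s + l * k) * coef k s t (suc l) m ≡
  suc (l + m) * ((s + (l + m) * k) * (t + (l + m) * k)) * coef k s t l m
coef-suc k s t l m = begin
  suc l * (s + l * k) * (bin (suc l) m * (R k m (s + suc l * k) * R k (suc l) (t + m * k)))
    ≡⟨ lem₁ (suc l) (s + l * k) (bin (suc l) m) (R k m (s + suc l * k)) (R k (suc l) (t + m * k)) ⟩
  (suc l * bin (suc l) m) * (((s + l * k) * R k m (s + suc l * k)) * R k (suc l) (t + m * k))
    ≡⟨ cong₂ (λ x y → x * (y * R k (suc l) (t + m * k))) (bin-suc l m)
        (trans (cong (λ x → (s + l * k) * R k m x) (lem₀ s k (l * k))) (R-suc k m (s + l * k))) ⟩
  (suc (l + m) * bin l m) * ((R k m (s + l * k) * (s + l * k + m * k)) * R k (suc l) (t + m * k))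
    ≡⟨ cong (λ x → (suc (l + m) * bin l m) * ((R k m (s + l * k) * (s + l * k + m * k)) * x)) (R-suc k l (t + m * k)) ⟩
  (suc (l + m) * bin l m) * ((R k m (s + l * k) * (s + l * k + m * k)) * (R k l (t + m * k) * (t + m * k + l * k)))
    ≡⟨ lem₂ k s t l m (bin l m) (R k m (s + l * k)) (R k l (t + m * k)) ⟩
  suc (l + m) * ((s + (l + m) * k) * (t + (l + m) * k)) * coef k s t l m ∎
  where
  open ≡-Reasoning
  lem₀ : ∀ s k x → s + (k + x) ≡ s + x + k
  lem₀ = solve-∀
  lem₁ : ∀ L x b p q → L * x * (b * (p * q)) ≡ (L * b) * ((x * p) * q)
  lem₁ = solve-∀
  lem₂ : ∀ k s t l m b p q →
    ((1 + (l + m)) * b) * ((p * (s + l * k + m * k)) * (q * (t + m * k + l * k))) ≡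
    (1 + (l + m)) * ((s + (l + m) * k) * (t + (l + m) * k)) * (b * (p * q))
  lem₂ = solve-∀

-- Power series in d

Series : Set
Series = ℕ → ℕ

one : Series
one zero    = 1
one (suc j) = 0

-- Multiplication by v + d on series in d.
T : ℕ → Series → Series
T v g zero    = v * g 0
T v g (suc j) = v * g (suc j) + g j

Tⁿ : ℕ → ℕ → Series → Series
Tⁿ v zero    g = g
Tⁿ v (suc e) g = T v (Tⁿ v e g)

-- Multiplication by the variable `d`, not a derivative. Applied twice it imitates integrating
-- twice, with the denominators left out.
D : Series → Series
D g zero    = 0
D g (suc j) = g j

pw : ℕ → ℕ → Series
pw v m = Tⁿ v m one

Tⁿ-pw : ∀ v e m j → Tⁿ v e (pw v m) j ≡ pw v (e + m) j
Tⁿ-pw v zero    m j       = refl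
Tⁿ-pw v (suc e) m zero    = cong (v *_) (Tⁿ-pw v e m 0)
Tⁿ-pw v (suc e) m (suc j) = cong₂ (λ x y → v * x + y) (Tⁿ-pw v e m (suc j)) (Tⁿ-pw v e m j)

-- This is the derivative of `(v + d) ^ (m + 1)`, coefficient by coefficient; the induction on `m`
-- is the product rule for the factor `v + d`.
pw-suc : ∀ v m j → suc j * pw v (suc m) (suc j) ≡ suc m * pw v m j
pw-suc v zero    zero    = lem v
  where
  lem : ∀ v → 1 * (v * 0 + 1) ≡ 1 * 1
  lem = solve-∀
pw-suc v zero    (suc j) = lem j v
  where
  lem : ∀ j v → (2 + j) * (v * 0 + 0) ≡ 1 * 0
  lem = solve-∀
pw-suc v (suc m) zero = begin
  1 * (v * pw v (suc m) 1 + v * pw v m 0)         ≡⟨ lem v (pw v (suc m) 1) (pw v m 0) ⟩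
  v * (1 * pw v (suc m) 1) + v * pw v m 0         ≡⟨ cong (λ x → v * x + v * pw v m 0) (pw-suc v m 0) ⟩
  v * (suc m * pw v m 0) + v * pw v m 0           ≡⟨ lem′ v m (pw v m 0) ⟩
  suc (suc m) * (v * pw v m 0)                    ∎
  where
  open ≡-Reasoning
  lem : ∀ v x y → 1 * (v * x + v * y) ≡ v * (1 * x) + v * y
  lem = solve-∀
  lem′ : ∀ v m y → v * ((1 + m) * y) + v * y ≡ (2 + m) * (v * y)
  lem′ = solve-∀
pw-suc v (suc m) (suc j) = begin
  suc (suc j) * (v * p (suc (suc j)) + p (suc j))
    ≡⟨ lem v j (p (suc (suc j))) (p (suc j)) ⟩
  v * (suc (suc j) * p (suc (suc j))) + p (suc j) + suc j * p (suc j)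
    ≡⟨ cong₂ (λ x y → v * x + p (suc j) + y) (pw-suc v m (suc j)) (pw-suc v m j) ⟩
  v * (suc m * pw v m (suc j)) + p (suc j) + suc m * pw v m j
    ≡⟨ lem′ v m (pw v m (suc j)) (pw v m j) ⟩
  suc (suc m) * p (suc j) ∎
  where
  open ≡-Reasoning
  p : Series
  p = pw v (suc m)
  lem : ∀ v j x y → (2 + j) * (v * x + y) ≡ v * ((2 + j) * x) + y + (1 + j) * y
  lem = solve-∀
  lem′ : ∀ v m x y → v * ((1 + m) * x) + (v * x + y) + (1 + m) * y ≡ (2 + m) * (v * x + y)
  lem′ = solve-∀

pw-zero : ∀ v m → pw v m 0 ≡ v ^ m
pw-zero v zero    = refl
pw-zero v (suc m) = cong (v *_) (pw-zero v m)

pw-suc² : ∀ v m j → suc (suc j) * suc j * pw v (suc (suc m)) (suc (suc j)) ≡ suc (suc m) * suc m * pw v m j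
pw-suc² v m j = begin
  suc (suc j) * suc j * pw v (suc (suc m)) (suc (suc j))   ≡⟨ lem (suc (suc j)) (suc j) (pw v (suc (suc m)) (suc (suc j))) ⟩
  suc j * (suc (suc j) * pw v (suc (suc m)) (suc (suc j))) ≡⟨ cong (suc j *_) (pw-suc v (suc m) (suc j)) ⟩
  suc j * (suc (suc m) * pw v (suc m) (suc j))             ≡⟨ lem′ (suc j) (suc (suc m)) (pw v (suc m) (suc j)) ⟩
  suc (suc m) * (suc j * pw v (suc m) (suc j))             ≡⟨ cong (suc (suc m) *_) (pw-suc v m j) ⟩
  suc (suc m) * (suc m * pw v m j)                         ≡⟨ *-assoc (suc (suc m)) (suc m) (pw v m j) ⟨
  suc (suc m) * suc m * pw v m j                           ∎
  where
  open ≡-Reasoning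
  lem : ∀ a b c → a * b * c ≡ b * (a * c)
  lem = solve-∀
  lem′ : ∀ a b c → a * (b * c) ≡ b * (a * c)
  lem′ = solve-∀

T-S : ∀ v (F : ℕ → ℕ → Series) n j → T v (λ i → S (λ l m → F l m i) n) j ≡ S (λ l m → T v (F l m) j) n
T-S v F n zero    = sym (S-* v (λ l m → F l m 0) n)
T-S v F n (suc j) = trans (cong (_+ S (λ l m → F l m j) n) (sym (S-* v (λ l m → F l m (suc j)) n)))
  (sym (S-+ (λ l m → v * F l m (suc j)) (λ l m → F l m j) n))

T-cong : ∀ v {g h} → (∀ j → g j ≡ h j) → ∀ j → T v g j ≡ T v h j
T-cong v eq zero    = cong (v *_) (eq 0)
T-cong v eq (suc j) = cong₂ (λ x y → v * x + y) (eq (suc j)) (eq j)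

T-* : ∀ v c g j → T v (λ i → c * g i) j ≡ c * T v g j
T-* v c g zero    = lem v c (g 0)
  where
  lem : ∀ v c x → v * (c * x) ≡ c * (v * x)
  lem = solve-∀
T-* v c g (suc j) = lem v c (g (suc j)) (g j)
  where
  lem : ∀ v c x y → v * (c * x) + c * y ≡ c * (v * x + y)
  lem = solve-∀

Tⁿ-S : ∀ v e (F : ℕ → ℕ → Series) n j → Tⁿ v e (λ i → S (λ l m → F l m i) n) j ≡ S (λ l m → Tⁿ v e (F l m) j) n
Tⁿ-S v zero    F n j = refl
Tⁿ-S v (suc e) F n j = trans (T-cong v (Tⁿ-S v e F n) j) (T-S v (λ l m → Tⁿ v e (F l m)) n j)

Tⁿ-* : ∀ v e c g j → Tⁿ v e (λ i → c * g i) j ≡ c * Tⁿ v e g j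
Tⁿ-* v zero    c g j = refl
Tⁿ-* v (suc e) c g j = trans (T-cong v (Tⁿ-* v e c g) j) (T-* v c (Tⁿ v e g) j)

Tⁿ-mono : ∀ v e {g h} → (∀ j → g j ≤ h j) → ∀ j → Tⁿ v e g j ≤ Tⁿ v e h j
Tⁿ-mono v zero    le j       = le j
Tⁿ-mono v (suc e) le zero    = *-monoʳ-≤ v (Tⁿ-mono v e le 0)
Tⁿ-mono v (suc e) le (suc j) = +-mono-≤ (*-monoʳ-≤ v (Tⁿ-mono v e le (suc j))) (Tⁿ-mono v e le j)

Tⁿ-mono-< : ∀ v e {g h} .{{_ : NonZero v}} → (∀ j → g j ≤ h j) → ∀ j → g j < h j → Tⁿ v e g j < Tⁿ v e h j
Tⁿ-mono-< v zero    le j       lt = lt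
Tⁿ-mono-< v (suc e) le zero    lt = *-monoʳ-< v (Tⁿ-mono-< v e le 0 lt)
Tⁿ-mono-< v (suc e) le (suc j) lt = +-mono-<-≤ (*-monoʳ-< v (Tⁿ-mono-< v e le (suc j) lt)) (Tⁿ-mono v e le j)

-- Multiplication by `v + d` has nonnegative coefficients and hence preserves coefficientwise
-- domination. The scalars `c` and `c′` stand for a rational factor `c′ / c`.
Tⁿ-dominated : ∀ v e c c′ {f g h} → (∀ j → c * f j ≤ c * g j + c′ * h j) →
  ∀ j → c * Tⁿ v e f j ≤ c * Tⁿ v e g j + c′ * Tⁿ v e h j
Tⁿ-dominated v zero    c c′ le j = le j
Tⁿ-dominated v (suc e) c c′ {f} {g} {h} le zero = begin
  c * (v * f′ 0)                    ≡⟨ lem v c (f′ 0) ⟩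
  v * (c * f′ 0)                    ≤⟨ *-monoʳ-≤ v (Tⁿ-dominated v e c c′ le 0) ⟩
  v * (c * g′ 0 + c′ * h′ 0)        ≡⟨ lem′ v c c′ (g′ 0) (h′ 0) ⟩
  c * (v * g′ 0) + c′ * (v * h′ 0)  ∎
  where
  open ≤-Reasoning
  f′ g′ h′ : Series
  f′ = Tⁿ v e f
  g′ = Tⁿ v e g
  h′ = Tⁿ v e h
  lem : ∀ v c x → c * (v * x) ≡ v * (c * x)
  lem = solve-∀
  lem′ : ∀ v c c′ x y → v * (c * x + c′ * y) ≡ c * (v * x) + c′ * (v * y)
  lem′ = solve-∀
Tⁿ-dominated v (suc e) c c′ {f} {g} {h} le (suc j) = begin
  c * (v * f′ (suc j) + f′ j)       ≡⟨ lem v c (f′ (suc j)) (f′ j) ⟩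
  v * (c * f′ (suc j)) + c * f′ j
    ≤⟨ +-mono-≤ (*-monoʳ-≤ v (Tⁿ-dominated v e c c′ le (suc j))) (Tⁿ-dominated v e c c′ le j) ⟩
  v * (c * g′ (suc j) + c′ * h′ (suc j)) + (c * g′ j + c′ * h′ j)
    ≡⟨ lem′ v c c′ (g′ (suc j)) (h′ (suc j)) (g′ j) (h′ j) ⟩
  c * (v * g′ (suc j) + g′ j) + c′ * (v * h′ (suc j) + h′ j) ∎
  where
  open ≤-Reasoning
  f′ g′ h′ : Series
  f′ = Tⁿ v e f
  g′ = Tⁿ v e g
  h′ = Tⁿ v e h
  lem : ∀ v c x y → c * (v * x + y) ≡ v * (c * x) + c * y
  lem = solve-∀
  lem′ : ∀ v c c′ x y z w → v * (c * x + c′ * y) + (c * z + c′ * w) ≡ c * (v * x + z) + c′ * (v * y + w)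
  lem′ = solve-∀

Tⁿ-vanish : ∀ v e r {g} → (∀ j → j < r → g j ≡ 0) → ∀ j → j < r → Tⁿ v e g j ≡ 0
Tⁿ-vanish v zero    r van j       lt = van j lt
Tⁿ-vanish v (suc e) r van zero    lt = trans (cong (v *_) (Tⁿ-vanish v e r van 0 lt)) (*-zeroʳ v)
Tⁿ-vanish v (suc e) r van (suc j) lt = cong₂ _+_
  (trans (cong (v *_) (Tⁿ-vanish v e r van (suc j) lt)) (*-zeroʳ v)) (Tⁿ-vanish v e r van j (<-trans (n<1+n j) lt))

-- Horner evaluation of the first `J` coefficients. It is exact once `J` exceeds the degree, and
-- truncating earlier can only lower the value.
ev : ℕ → ℕ → Series → ℕ
ev d zero    g = 0
ev d (suc J) g = g 0 + d * ev d J (g ∘ suc)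

ev-mono : ∀ d J {g h} → (∀ j → g j ≤ h j) → ev d J g ≤ ev d J h
ev-mono d zero    le = z≤n
ev-mono d (suc J) le = +-mono-≤ (le 0) (*-monoʳ-≤ d (ev-mono d J (le ∘ suc)))

ev-mono-< : ∀ d J {g h} .{{_ : NonZero d}} → (∀ j → g j ≤ h j) → ∀ i → i < J → g i < h i → ev d J g < ev d J h
ev-mono-< d (suc J) le zero    lt gh = +-mono-<-≤ gh (*-monoʳ-≤ d (ev-mono d J (le ∘ suc)))
ev-mono-< d (suc J) le (suc i) lt gh = +-mono-≤-< (le 0) (*-monoʳ-< d (ev-mono-< d J (le ∘ suc) i (≤-pred lt) gh))

ev-+ : ∀ d J g h → ev d J (λ j → g j + h j) ≡ ev d J g + ev d J h
ev-+ d zero    g h = refl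
ev-+ d (suc J) g h = trans (cong (λ x → g 0 + h 0 + d * x) (ev-+ d J (g ∘ suc) (h ∘ suc))) (lem d (g 0) (h 0) _ _)
  where
  lem : ∀ d a b x y → a + b + d * (x + y) ≡ a + d * x + (b + d * y)
  lem = solve-∀

ev-* : ∀ d J c g → ev d J (λ j → c * g j) ≡ c * ev d J g
ev-* d zero    c g = sym (*-zeroʳ c)
ev-* d (suc J) c g = trans (cong (λ x → c * g 0 + d * x) (ev-* d J c (g ∘ suc))) (lem d c (g 0) _)
  where
  lem : ∀ d c a x → c * a + d * (c * x) ≡ c * (a + d * x)
  lem = solve-∀

ev-S : ∀ d J (F : ℕ → ℕ → Series) n → ev d J (λ i → S (λ l m → F l m i) n) ≡ S (λ l m → ev d J (F l m)) n
ev-S d J F zero    = refl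
ev-S d J F (suc n) = trans (ev-+ d J (F 0 (suc n)) (λ i → S (λ l m → F (suc l) m i) n))
  (cong (ev d J (F 0 (suc n)) +_) (ev-S d J (F ∘ suc) n))

ev-T : ∀ v d J g → ev d (suc J) (T v g) ≡ v * ev d (suc J) g + d * ev d J g
ev-T v d J g = trans (cong (λ x → v * g 0 + d * x)
    (trans (ev-+ d J (λ j → v * g (suc j)) g) (cong (_+ ev d J g) (ev-* d J v (g ∘ suc)))))
  (lem v d (g 0) (ev d J (g ∘ suc)) (ev d J g))
  where
  lem : ∀ v d a x y → v * a + d * (v * x + y) ≡ v * (a + d * x) + d * y
  lem = solve-∀

ev-zero : ∀ d J → ev d J (λ _ → 0) ≡ 0
ev-zero d zero    = refl
ev-zero d (suc J) = trans (cong (d *_) (ev-zero d J)) (*-zeroʳ d)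

ev-pw : ∀ v d m J → m < J → ev d J (pw v m) ≡ (v + d) ^ m
ev-pw v d zero (suc J) lt = cong suc (trans (cong (d *_) (ev-zero d J)) (*-zeroʳ d))
ev-pw v d (suc m) (suc J) (s≤s lt) = trans (ev-T v d J (pw v m))
  (trans (cong₂ (λ x y → v * x + d * y) (ev-pw v d m (suc J) (≤-trans lt (n≤1+n J))) (ev-pw v d m J lt))
    (sym (*-distribʳ-+ ((v + d) ^ m) v d)))

ev-last : ∀ d J g → ev d J g ≤ ev d (suc J) g
ev-last d zero    g = z≤n
ev-last d (suc J) g = +-monoʳ-≤ (g 0) (*-monoʳ-≤ d (ev-last d J (g ∘ suc)))

-- Only an inequality, since truncation drops the top coefficient of the product.
ev-T-≤ : ∀ v d J g → ev d J (T v g) ≤ (v + d) * ev d J g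
ev-T-≤ v d zero    g = z≤n
ev-T-≤ v d (suc J) g = begin
  ev d (suc J) (T v g)                    ≡⟨ ev-T v d J g ⟩
  v * ev d (suc J) g + d * ev d J g       ≤⟨ +-monoʳ-≤ (v * ev d (suc J) g) (*-monoʳ-≤ d (ev-last d J g)) ⟩
  v * ev d (suc J) g + d * ev d (suc J) g ≡⟨ *-distribʳ-+ (ev d (suc J) g) v d ⟨
  (v + d) * ev d (suc J) g                ∎
  where open ≤-Reasoning

ev-Tⁿ-≤ : ∀ v d J e g → ev d J (Tⁿ v e g) ≤ (v + d) ^ e * ev d J g
ev-Tⁿ-≤ v d J zero    g = ≤-reflexive (sym (*-identityˡ _))
ev-Tⁿ-≤ v d J (suc e) g = begin
  ev d J (T v (Tⁿ v e g))              ≤⟨ ev-T-≤ v d J (Tⁿ v e g) ⟩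
  (v + d) * ev d J (Tⁿ v e g)          ≤⟨ *-monoʳ-≤ (v + d) (ev-Tⁿ-≤ v d J e g) ⟩
  (v + d) * ((v + d) ^ e * ev d J g)   ≡⟨ *-assoc (v + d) _ _ ⟨
  (v + d) * (v + d) ^ e * ev d J g     ∎
  where open ≤-Reasoning

ev-D-≤ : ∀ d J g → ev d J (D g) ≤ d * ev d J g
ev-D-≤ d zero    g = z≤n
ev-D-≤ d (suc J) g = *-monoʳ-≤ d (ev-last d J g)

-- The differential equation of the Padé forms

coef-sum-sucˡ : ∀ k n s t → S (coef k (s + k) t) n ≡ R k n (s + t + n * k)
coef-sum-sucˡ k n s t = trans (coef-sum k n (s + k) t)
  (trans (cong (λ x → R k n (x + pred n * k)) (lem s t k)) (R-pred k n (s + t)))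
  where
  lem : ∀ s t k → s + k + t ≡ s + t + k
  lem = solve-∀

-- The factor `l` is absorbed by the binomial, which turns `s` into `s + k`, so that `coef-sum`
-- applies again.
coef-sum-l : ∀ k n s t → S (λ l m → l * coef k s t l m) (suc n) ≡ suc n * (t + n * k) * R k n (s + t + n * k)
coef-sum-l k n s t = begin
  S (λ l m → suc l * coef k s t (suc l) m) n
    ≡⟨ S-cong n step ⟩
  S (λ l m → suc n * (t + n * k) * coef k (s + k) t l m) n
    ≡⟨ S-* (suc n * (t + n * k)) (coef k (s + k) t) n ⟩
  suc n * (t + n * k) * S (coef k (s + k) t) n
    ≡⟨ cong (suc n * (t + n * k) *_) (coef-sum-sucˡ k n s t) ⟩
  suc n * (t + n * k) * R k n (s + t + n * k) ∎
  where
  open ≡-Reasoning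
  step : ∀ l m → l + m ≡ n → suc l * coef k s t (suc l) m ≡ suc n * (t + n * k) * coef k (s + k) t l m
  step l m refl = begin
    suc l * (bin (suc l) m * (R k m (s + suc l * k) * R k (suc l) (t + m * k)))
      ≡⟨ *-assoc (suc l) (bin (suc l) m) _ ⟨
    suc l * bin (suc l) m * (R k m (s + suc l * k) * R k (suc l) (t + m * k))
      ≡⟨ cong₂ _*_ (bin-suc l m) (cong₂ _*_ (cong (R k m) (sym (+-assoc s k (l * k)))) (R-suc k l (t + m * k))) ⟩
    suc (l + m) * bin l m * (R k m (s + k + l * k) * (R k l (t + m * k) * (t + m * k + l * k)))
      ≡⟨ lem k t l m (bin l m) (R k m (s + k + l * k)) (R k l (t + m * k)) ⟩
    suc (l + m) * (t + (l + m) * k) * coef k (s + k) t l m ∎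
    where
    lem : ∀ k t l m b p q → (1 + (l + m)) * b * (p * (q * (t + m * k + l * k))) ≡ (1 + (l + m)) * (t + (l + m) * k) * (b * (p * q))
    lem = solve-∀

module _ (e : ℕ) where

  private
    k σ τ : ℕ
    k = 2 + e
    σ = 3 + e
    τ = 1 + e

  coef-sum-sym : ∀ n → S (coef k τ σ) n ≡ S (coef k σ τ) n
  coef-sum-sym n = trans (coef-sum k n τ σ) (trans (cong (λ x → R k n (x + pred n * k)) (+-comm τ σ)) (sym (coef-sum k n σ τ)))

  -- This is the equality of the first derivatives of `u A` and `v B` at `u = v`. Since
  -- `σ + τ = 2 k`, the extra sum of coefficients equals `2 k (n + 1) r`, which is just what turns
  -- `τ + n k` into `σ + n k`, because `σ = τ + 2`.
  coef-moment : ∀ n → S (λ l m → coef k σ τ l m * (k * l + 1)) (suc n) ≡ S (λ l m → coef k τ σ l m * (k * l)) (suc n)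
  coef-moment n = begin
    S (λ l m → coef k σ τ l m * (k * l + 1)) (suc n)
      ≡⟨ S-cong (suc n) (λ l m _ → lem₁ k l (coef k σ τ l m)) ⟩
    S (λ l m → k * (l * coef k σ τ l m) + coef k σ τ l m) (suc n)
      ≡⟨ trans (S-+ (λ l m → k * (l * coef k σ τ l m)) (coef k σ τ) (suc n))
           (cong₂ _+_ (trans (S-* k (λ l m → l * coef k σ τ l m) (suc n)) (cong (k *_) (coef-sum-l k n σ τ)))
                      (trans (coef-sum k (suc n) σ τ) (R-suc k n (σ + τ + n * k)))) ⟩
    k * (suc n * (τ + n * k) * r) + r * (σ + τ + n * k + n * k)
      ≡⟨ lem₂ e n r ⟩
    k * (suc n * (σ + n * k) * r)
      ≡⟨ cong (λ x → k * (suc n * (σ + n * k) * R k n (x + n * k))) (+-comm σ τ) ⟩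
    k * (suc n * (σ + n * k) * R k n (τ + σ + n * k))
      ≡⟨ trans (S-* k (λ l m → l * coef k τ σ l m) (suc n)) (cong (k *_) (coef-sum-l k n τ σ)) ⟨
    S (λ l m → k * (l * coef k τ σ l m)) (suc n)
      ≡⟨ S-cong (suc n) (λ l m _ → lem₃ k l (coef k τ σ l m)) ⟩
    S (λ l m → coef k τ σ l m * (k * l)) (suc n) ∎
    where
    open ≡-Reasoning
    r : ℕ
    r = R k n (σ + τ + n * k)
    lem₁ : ∀ k l c → c * (k * l + 1) ≡ k * (l * c) + c
    lem₁ = solve-∀
    lem₂ : ∀ e n r → (2 + e) * ((1 + n) * ((1 + e) + n * (2 + e)) * r) + r * ((3 + e) + (1 + e) + n * (2 + e) + n * (2 + e))
      ≡ (2 + e) * ((1 + n) * ((3 + e) + n * (2 + e)) * r)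
    lem₂ = solve-∀
    lem₃ : ∀ k l c → k * (l * c) ≡ c * (k * l)
    lem₃ = solve-∀

  -- The expansion in d of w uˣ Σ coef u^(k l) v^(k m) at u = v + d; α and β below are u A and v B.
  ser : (s t x w v n : ℕ) → Series
  ser s t x w v n j = S (λ l m → coef k s t l m * (w * v ^ (k * m)) * pw v (k * l + x) j) n

  Cₙ : ℕ → ℕ
  Cₙ n = k * (suc n * ((σ + n * k) * (τ + n * k)))

  -- Two derivatives of `u ^ (k (l + 1) + x)` leave `u ^ (k - 2)` times `u ^ (k l + x)`, with a
  -- factor that `H` identifies with the left factor in `coef-suc`. Term `l + 1` at level `n + 1`
  -- therefore matches term `l` at level `n`. The term `l = 0` is annihilated, which is `van`.
  ser-ode : ∀ s t x w v n j → (∀ j → pw v x (2 + j) ≡ 0) →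
    (∀ l → suc (suc (e + (k * l + x))) * suc (e + (k * l + x)) ≡ k * (suc l * (s + l * k))) →
    suc (suc j) * suc j * ser s t x w v (suc n) (suc (suc j)) ≡
    k * (suc n * ((s + n * k) * (t + n * k))) * Tⁿ v e (ser s t x w v n) j
  ser-ode s t x w v n j van H = begin
    J * ser s t x w v (suc n) (2 + j)
      ≡⟨ cong (λ y → J * (coef k s t 0 (suc n) * (w * v ^ (k * suc n)) * y + S G n))
           (trans (cong (λ y → pw v (y + x) (2 + j)) (*-zeroʳ k)) (van j)) ⟩
    J * (coef k s t 0 (suc n) * (w * v ^ (k * suc n)) * 0 + S G n)
      ≡⟨ cong (λ y → J * (y + S G n)) (*-zeroʳ (coef k s t 0 (suc n) * (w * v ^ (k * suc n)))) ⟩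
    J * S G n
      ≡⟨ S-* J G n ⟨
    S (λ l m → J * G l m) n
      ≡⟨ S-cong n step ⟩
    S (λ l m → C * Tⁿ v e (F l m) j) n
      ≡⟨ S-* C (λ l m → Tⁿ v e (F l m) j) n ⟩
    C * S (λ l m → Tⁿ v e (F l m) j) n
      ≡⟨ cong (C *_) (Tⁿ-S v e F n j) ⟨
    C * Tⁿ v e (ser s t x w v n) j ∎
    where
    open ≡-Reasoning
    J C : ℕ
    J = suc (suc j) * suc j
    C = k * (suc n * ((s + n * k) * (t + n * k)))
    G : ℕ → ℕ → ℕ
    G l m = coef k s t (suc l) m * (w * v ^ (k * m)) * pw v (k * suc l + x) (2 + j)
    F : ℕ → ℕ → Series
    F l m j = coef k s t l m * (w * v ^ (k * m)) * pw v (k * l + x) j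
    index : ∀ e l x → (2 + e) * (1 + l) + x ≡ 2 + (e + ((2 + e) * l + x))
    index = solve-∀
    step : ∀ l m → l + m ≡ n → J * G l m ≡ C * Tⁿ v e (F l m) j
    step l m refl = begin
      J * (c′ * W * pw v (k * suc l + x) (2 + j))
        ≡⟨ cong (λ y → J * (c′ * W * pw v y (2 + j))) (index e l x) ⟩
      J * (c′ * W * pw v (2 + M) (2 + j))
        ≡⟨ lem₁ J (c′ * W) (pw v (2 + M) (2 + j)) ⟩
      c′ * W * (J * pw v (2 + M) (2 + j))
        ≡⟨ cong (c′ * W *_) (pw-suc² v M j) ⟩
      c′ * W * (suc (suc M) * suc M * pw v M j)
        ≡⟨ cong₂ (λ y z → c′ * W * (y * z)) (H l) (sym (Tⁿ-pw v e (k * l + x) j)) ⟩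
      c′ * W * (k * (suc l * (s + l * k)) * P)
        ≡⟨ lem₂ c′ W k (suc l * (s + l * k)) P ⟩
      k * (suc l * (s + l * k) * c′) * W * P
        ≡⟨ cong (λ y → k * y * W * P) (coef-suc k s t l m) ⟩
      k * (suc n * ((s + n * k) * (t + n * k)) * c) * W * P
        ≡⟨ lem₃ k (suc n * ((s + n * k) * (t + n * k))) c W P ⟩
      C * (c * W * P)
        ≡⟨ cong (C *_) (Tⁿ-* v e (c * W) (pw v (k * l + x)) j) ⟨
      C * Tⁿ v e (F l m) j ∎
      where
      c c′ W M P : ℕ
      c = coef k s t l m
      c′ = coef k s t (suc l) m
      W = w * v ^ (k * m)
      M = e + (k * l + x)
      P = Tⁿ v e (pw v (k * l + x)) j
      lem₁ : ∀ J c p → J * (c * p) ≡ c * (J * p)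
      lem₁ = solve-∀
      lem₂ : ∀ c W k x P → c * W * (k * x * P) ≡ k * (x * c) * W * P
      lem₂ = solve-∀
      lem₃ : ∀ k x c W P → k * (x * c) * W * P ≡ k * x * (c * W * P)
      lem₃ = solve-∀

  α β : (v n : ℕ) → Series
  α = ser σ τ 1 1
  β v = ser τ σ 0 v v

  α-ode : ∀ v n j → suc (suc j) * suc j * α v (suc n) (suc (suc j)) ≡ Cₙ n * Tⁿ v e (α v n) j
  α-ode v n j = ser-ode σ τ 1 1 v n j van (λ l → lem e l)
    where
    van : ∀ j → pw v 1 (2 + j) ≡ 0
    van j = trans (+-identityʳ (v * 0)) (*-zeroʳ v)
    lem : ∀ e l → (2 + (e + ((2 + e) * l + 1))) * (1 + (e + ((2 + e) * l + 1))) ≡ (2 + e) * ((1 + l) * ((3 + e) + l * (2 + e)))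
    lem = solve-∀

  β-ode : ∀ v n j → suc (suc j) * suc j * β v (suc n) (suc (suc j)) ≡ Cₙ n * Tⁿ v e (β v n) j
  β-ode v n j = trans (ser-ode τ σ 0 v v n j (λ _ → refl) (λ l → lem e l))
    (cong (λ y → k * (suc n * y) * Tⁿ v e (β v n) j) (*-comm (τ + n * k) (σ + n * k)))
    where
    lem : ∀ e l → (2 + (e + ((2 + e) * l + 0))) * (1 + (e + ((2 + e) * l + 0))) ≡ (2 + e) * ((1 + l) * ((1 + e) + l * (2 + e)))
    lem = solve-∀

  ^-antidiagonal : ∀ v l m → v ^ (k * m) * v ^ (k * l) ≡ v ^ (k * (l + m))
  ^-antidiagonal v l m = trans (sym (^-distribˡ-+-* v (k * m) (k * l))) (cong (v ^_) (lem k l m))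
    where
    lem : ∀ k l m → k * m + k * l ≡ k * (l + m)
    lem = solve-∀

  α₀≡β₀ : ∀ v n → α v n 0 ≡ β v n 0
  α₀≡β₀ v n = begin
    α v n 0                        ≡⟨ S-cong n α-step ⟩
    S (λ l m → V * coef k σ τ l m) n ≡⟨ S-* V (coef k σ τ) n ⟩
    V * S (coef k σ τ) n           ≡⟨ cong (V *_) (coef-sum-sym n) ⟨
    V * S (coef k τ σ) n           ≡⟨ S-* V (coef k τ σ) n ⟨
    S (λ l m → V * coef k τ σ l m) n ≡⟨ S-cong n β-step ⟨
    β v n 0                        ∎
    where
    open ≡-Reasoning
    V : ℕ
    V = v * v ^ (k * n)
    α-step : ∀ l m → l + m ≡ n → coef k σ τ l m * (1 * v ^ (k * m)) * pw v (k * l + 1) 0 ≡ V * coef k σ τ l m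
    α-step l m refl = begin
      c * (1 * v ^ (k * m)) * pw v (k * l + 1) 0
        ≡⟨ cong (λ y → c * (1 * v ^ (k * m)) * y) (trans (pw-zero v (k * l + 1)) (cong (v ^_) (+-comm (k * l) 1))) ⟩
      c * (1 * v ^ (k * m)) * (v * v ^ (k * l)) ≡⟨ lem c v (v ^ (k * m)) (v ^ (k * l)) ⟩
      v * (v ^ (k * m) * v ^ (k * l)) * c       ≡⟨ cong (λ y → v * y * c) (^-antidiagonal v l m) ⟩
      V * c                                     ∎
      where
      c : ℕ
      c = coef k σ τ l m
      lem : ∀ c v x y → c * (1 * x) * (v * y) ≡ v * (x * y) * c
      lem = solve-∀
    β-step : ∀ l m → l + m ≡ n → coef k τ σ l m * (v * v ^ (k * m)) * pw v (k * l + 0) 0 ≡ V * coef k τ σ l m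
    β-step l m refl = begin
      c * (v * v ^ (k * m)) * pw v (k * l + 0) 0
        ≡⟨ cong (λ y → c * (v * v ^ (k * m)) * y) (trans (pw-zero v (k * l + 0)) (cong (v ^_) (+-identityʳ (k * l)))) ⟩
      c * (v * v ^ (k * m)) * v ^ (k * l)       ≡⟨ lem c v (v ^ (k * m)) (v ^ (k * l)) ⟩
      v * (v ^ (k * m) * v ^ (k * l)) * c       ≡⟨ cong (λ y → v * y * c) (^-antidiagonal v l m) ⟩
      V * c                                     ∎
      where
      c : ℕ
      c = coef k τ σ l m
      lem : ∀ c v x y → c * (v * x) * y ≡ v * (x * y) * c
      lem = solve-∀

  -- The factor `v` avoids the exponent `m - 1`; it is the factor `v` of `v B`.
  v*pw-one : ∀ v m → v * pw v m 1 ≡ m * v ^ m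
  v*pw-one v zero    = *-zeroʳ v
  v*pw-one v (suc m) = begin
    v * pw v (suc m) 1        ≡⟨ cong (v *_) (trans (sym (*-identityˡ _)) (pw-suc v m 0)) ⟩
    v * (suc m * pw v m 0)    ≡⟨ cong (λ x → v * (suc m * x)) (pw-zero v m) ⟩
    v * (suc m * v ^ m)       ≡⟨ lem v (suc m) (v ^ m) ⟩
    suc m * (v * v ^ m)       ∎
    where
    open ≡-Reasoning
    lem : ∀ v m x → v * (m * x) ≡ m * (v * x)
    lem = solve-∀

  α₁≡β₁ : ∀ v n → α v (suc n) 1 ≡ β v (suc n) 1
  α₁≡β₁ v n = begin
    α v (suc n) 1                                         ≡⟨ S-cong (suc n) α-step ⟩
    S (λ l m → V * (coef k σ τ l m * (k * l + 1))) (suc n) ≡⟨ S-* V (λ l m → coef k σ τ l m * (k * l + 1)) (suc n) ⟩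
    V * S (λ l m → coef k σ τ l m * (k * l + 1)) (suc n)   ≡⟨ cong (V *_) (coef-moment n) ⟩
    V * S (λ l m → coef k τ σ l m * (k * l)) (suc n)       ≡⟨ S-* V (λ l m → coef k τ σ l m * (k * l)) (suc n) ⟨
    S (λ l m → V * (coef k τ σ l m * (k * l))) (suc n)     ≡⟨ S-cong (suc n) β-step ⟨
    β v (suc n) 1                                          ∎
    where
    open ≡-Reasoning
    V : ℕ
    V = v ^ (k * suc n)
    α-step : ∀ l m → l + m ≡ suc n → coef k σ τ l m * (1 * v ^ (k * m)) * pw v (k * l + 1) 1 ≡ V * (coef k σ τ l m * (k * l + 1))
    α-step l m p = begin
      c * (1 * v ^ (k * m)) * pw v (k * l + 1) 1
        ≡⟨ cong (λ y → c * (1 * v ^ (k * m)) * pw v y 1) (+-comm (k * l) 1) ⟩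
      c * (1 * v ^ (k * m)) * pw v (suc (k * l)) 1
        ≡⟨ cong (λ y → c * (1 * v ^ (k * m)) * y) (trans (sym (*-identityˡ _)) (trans (pw-suc v (k * l) 0) (cong (suc (k * l) *_) (pw-zero v (k * l))))) ⟩
      c * (1 * v ^ (k * m)) * (suc (k * l) * v ^ (k * l))
        ≡⟨ lem c (v ^ (k * m)) (k * l) (v ^ (k * l)) ⟩
      v ^ (k * m) * v ^ (k * l) * (c * (k * l + 1))
        ≡⟨ cong (_* (c * (k * l + 1))) (trans (^-antidiagonal v l m) (cong (λ y → v ^ (k * y)) p)) ⟩
      V * (c * (k * l + 1)) ∎
      where
      c : ℕ
      c = coef k σ τ l m
      lem : ∀ c x l y → c * (1 * x) * ((1 + l) * y) ≡ x * y * (c * (l + 1))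
      lem = solve-∀
    β-step : ∀ l m → l + m ≡ suc n → coef k τ σ l m * (v * v ^ (k * m)) * pw v (k * l + 0) 1 ≡ V * (coef k τ σ l m * (k * l))
    β-step l m p = begin
      c * (v * v ^ (k * m)) * pw v (k * l + 0) 1
        ≡⟨ cong (λ y → c * (v * v ^ (k * m)) * pw v y 1) (+-identityʳ (k * l)) ⟩
      c * (v * v ^ (k * m)) * pw v (k * l) 1
        ≡⟨ lem₁ c v (v ^ (k * m)) (pw v (k * l) 1) ⟩
      c * v ^ (k * m) * (v * pw v (k * l) 1)
        ≡⟨ cong (c * v ^ (k * m) *_) (v*pw-one v (k * l)) ⟩
      c * v ^ (k * m) * (k * l * v ^ (k * l))
        ≡⟨ lem₂ c (v ^ (k * m)) (k * l) (v ^ (k * l)) ⟩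
      v ^ (k * m) * v ^ (k * l) * (c * (k * l))
        ≡⟨ cong (_* (c * (k * l))) (trans (^-antidiagonal v l m) (cong (λ y → v ^ (k * y)) p)) ⟩
      V * (c * (k * l)) ∎
      where
      c : ℕ
      c = coef k τ σ l m
      lem₁ : ∀ c v x y → c * (v * x) * y ≡ c * x * (v * y)
      lem₁ = solve-∀
      lem₂ : ∀ c x l y → c * x * (l * y) ≡ x * y * (c * l)
      lem₂ = solve-∀

-- Bounds for the Padé forms

hom : (k s t n U V : ℕ) → ℕ
hom k s t n U V = S (λ l m → coef k s t l m * (U ^ l * V ^ m)) n

module _ (e : ℕ) where

  private
    k σ τ : ℕ
    k = 2 + e
    σ = 3 + e
    τ = 1 + e

  -- At level 0 the series are `v` and `v + d`. From there on, the first two coefficients agree and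
  -- both series obey the same recurrence with nonnegative multipliers, so the order is inherited.
  β≤α : ∀ v n j → β e v n j ≤ α e v n j
  β≤α v n       zero          = ≤-reflexive (sym (α₀≡β₀ e v n))
  β≤α v zero    (suc zero)    = subst (_≤ α e v 0 1) (sym lem) z≤n
    where
    lem : 1 * (v * v ^ (k * 0)) * pw v (k * 0 + 0) 1 ≡ 0
    lem = trans (cong (λ x → 1 * (v * v ^ (k * 0)) * pw v (x + 0) 1) (*-zeroʳ k)) (*-zeroʳ (1 * (v * v ^ (k * 0))))
  β≤α v (suc n) (suc zero)    = ≤-reflexive (sym (α₁≡β₁ e v n))
  β≤α v zero    (suc (suc j)) = subst (_≤ α e v 0 (2 + j)) (sym lem) z≤n
    where
    lem : 1 * (v * v ^ (k * 0)) * pw v (k * 0 + 0) (2 + j) ≡ 0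
    lem = trans (cong (λ x → 1 * (v * v ^ (k * 0)) * pw v (x + 0) (2 + j)) (*-zeroʳ k)) (*-zeroʳ (1 * (v * v ^ (k * 0))))
  β≤α v (suc n) (suc (suc j)) = *-cancelˡ-≤ (suc (suc j) * suc j) (begin
    suc (suc j) * suc j * β e v (suc n) (suc (suc j)) ≡⟨ β-ode e v n j ⟩
    Cₙ e n * Tⁿ v e (β e v n) j                       ≤⟨ *-monoʳ-≤ (Cₙ e n) (Tⁿ-mono v e (β≤α v n) j) ⟩
    Cₙ e n * Tⁿ v e (α e v n) j                       ≡⟨ α-ode e v n j ⟨
    suc (suc j) * suc j * α e v (suc n) (suc (suc j)) ∎)
    where open ≤-Reasoning

  -- The order of vanishing of the linear form at `d = 0`, namely `2 n + 1`; each level adds 2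
  -- because it integrates twice.
  order : ℕ → ℕ
  order zero    = 1
  order (suc n) = suc (suc (order n))

  β<α : ∀ v n .{{_ : NonZero v}} → β e v n (order n) < α e v n (order n)
  β<α v zero    = subst₂ _<_ (sym lem) (sym lem′) (n<1+n 0)
    where
    lem : 1 * (v * v ^ (k * 0)) * pw v (k * 0 + 0) 1 ≡ 0
    lem = trans (cong (λ x → 1 * (v * v ^ (k * 0)) * pw v (x + 0) 1) (*-zeroʳ k)) (*-zeroʳ (1 * (v * v ^ (k * 0))))
    one′ : ∀ v → 1 * (1 * 1) * (v * 0 + 1) ≡ 1
    one′ = solve-∀
    lem′ : 1 * (1 * v ^ (k * 0)) * pw v (k * 0 + 1) 1 ≡ 1
    lem′ = trans (cong (λ x → 1 * (1 * v ^ x) * pw v (x + 1) 1) (*-zeroʳ k)) (one′ v)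
  β<α v (suc n) = *-cancelˡ-< (suc (suc j) * suc j) _ _ (begin-strict
    suc (suc j) * suc j * β e v (suc n) (suc (suc j)) ≡⟨ β-ode e v n j ⟩
    Cₙ e n * Tⁿ v e (β e v n) j                       <⟨ *-monoʳ-< (Cₙ e n) (Tⁿ-mono-< v e (β≤α v n) j (β<α v n)) ⟩
    Cₙ e n * Tⁿ v e (α e v n) j                       ≡⟨ α-ode e v n j ⟨
    suc (suc j) * suc j * α e v (suc n) (suc (suc j)) ∎)
    where
    open ≤-Reasoning
    j : ℕ
    j = order n

  -- The series of `d ^ (2 n + 1) * (v + d) ^ (e n)`: the recurrence of the linear form with its
  -- numerical constants moved into `num` and `den`.
  maj : ℕ → ℕ → Series
  maj v zero    = D one
  maj v (suc n) = D (D (Tⁿ v e (maj v n)))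

  maj-vanish : ∀ v n j → j < order n → maj v n j ≡ 0
  maj-vanish v zero    zero          lt = refl
  maj-vanish v zero    (suc j)       (s≤s ())
  maj-vanish v (suc n) zero          lt = refl
  maj-vanish v (suc n) (suc zero)    lt = refl
  maj-vanish v (suc n) (suc (suc j)) lt = Tⁿ-vanish v e (order n) (maj-vanish v n) j (≤-pred (≤-pred lt))

  -- num n / den n is the product of the Cⱼ / ((2 j + 2) (2 j + 3)), from integrating twice for each j < n.
  den num : ℕ → ℕ
  den zero    = 1
  den (suc n) = suc (suc (order n)) * suc (order n) * den n
  num zero    = 1
  num (suc n) = Cₙ e n * num n

  α-bound : ∀ v n j → den n * α e v n j ≤ den n * β e v n j + num n * maj v n j
  α-bound v n       zero          = ≤-trans (≤-reflexive (cong (den n *_) (α₀≡β₀ e v n))) (m≤m+n _ _)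
  α-bound v zero    (suc zero)    = ≤-trans (≤-reflexive lem) (m≤n+m 1 (1 * β e v 0 1))
    where
    one′ : ∀ v → 1 * (1 * (1 * 1) * (v * 0 + 1)) ≡ 1
    one′ = solve-∀
    lem : 1 * (1 * (1 * v ^ (k * 0)) * pw v (k * 0 + 1) 1) ≡ 1
    lem = trans (cong (λ x → 1 * (1 * (1 * v ^ x) * pw v (x + 1) 1)) (*-zeroʳ k)) (one′ v)
  α-bound v (suc n) (suc zero)    = ≤-trans (≤-reflexive (cong (den (suc n) *_) (α₁≡β₁ e v n))) (m≤m+n _ _)
  α-bound v zero    (suc (suc j)) = ≤-trans (≤-reflexive lem) z≤n
    where
    zero′ : ∀ v → 1 * (1 * (1 * 1) * (v * 0 + 0)) ≡ 0
    zero′ = solve-∀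
    lem : 1 * (1 * (1 * v ^ (k * 0)) * pw v (k * 0 + 1) (2 + j)) ≡ 0
    lem = trans (cong (λ x → 1 * (1 * (1 * v ^ x) * pw v (x + 1) (2 + j))) (*-zeroʳ k)) (zero′ v)
  α-bound v (suc n) (suc (suc j)) = *-cancelˡ-≤ J (begin
    J * (c * den n * α e v (suc n) (2 + j))               ≡⟨ lem₁ J c (den n) _ ⟩
    c * den n * (J * α e v (suc n) (2 + j))               ≡⟨ cong (c * den n *_) (α-ode e v n j) ⟩
    c * den n * (Cₙ e n * α′)                             ≡⟨ lem₂ c (den n) (Cₙ e n) α′ ⟩
    c * Cₙ e n * (den n * α′)                             ≤⟨ *-monoʳ-≤ (c * Cₙ e n) (Tⁿ-dominated v e (den n) (num n) (α-bound v n) j) ⟩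
    c * Cₙ e n * (den n * β′ + num n * h′)                  ≡⟨ lem₃ c (Cₙ e n) (den n) β′ (num n) h′ ⟩
    c * den n * (Cₙ e n * β′) + Cₙ e n * num n * (c * h′)   ≤⟨ +-monoʳ-≤ (c * den n * (Cₙ e n * β′)) (*-monoʳ-≤ (Cₙ e n * num n) c*h≤J*h) ⟩
    c * den n * (Cₙ e n * β′) + Cₙ e n * num n * (J * h′)   ≡⟨ cong (λ x → c * den n * x + Cₙ e n * num n * (J * h′)) (β-ode e v n j) ⟨
    c * den n * (J * β e v (suc n) (2 + j)) + Cₙ e n * num n * (J * h′)
      ≡⟨ lem₄ c (den n) J (β e v (suc n) (2 + j)) (Cₙ e n * num n) h′ ⟩
    J * (c * den n * β e v (suc n) (2 + j) + Cₙ e n * num n * h′) ∎)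
    where
    open ≤-Reasoning
    J c α′ β′ h′ : ℕ
    J = suc (suc j) * suc j
    c = suc (suc (order n)) * suc (order n)
    α′ = Tⁿ v e (α e v n) j
    β′ = Tⁿ v e (β e v n) j
    h′ = Tⁿ v e (maj v n) j
    -- The majorant has no terms below `order n`, so the denominator `(j + 2) (j + 1)` of the double
    -- integration may be replaced by its value at `j = order n`. This makes `den` independent of
    -- `j`.
    c*h≤J*h : c * h′ ≤ J * h′
    c*h≤J*h with order n ≤? j
    ... | yes p = *-monoˡ-≤ h′ (*-mono-≤ (s≤s (s≤s p)) (s≤s p))
    ... | no ¬p = ≤-trans (≤-reflexive (trans (cong (c *_) (Tⁿ-vanish v e (order n) (maj-vanish v n) j (≰⇒> ¬p))) (*-zeroʳ c))) z≤n
    lem₁ : ∀ J c g x → J * (c * g * x) ≡ c * g * (J * x)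
    lem₁ = solve-∀
    lem₂ : ∀ c g C x → c * g * (C * x) ≡ c * C * (g * x)
    lem₂ = solve-∀
    lem₃ : ∀ c C g b p h → c * C * (g * b + p * h) ≡ c * g * (C * b) + C * p * (c * h)
    lem₃ = solve-∀
    lem₄ : ∀ c g J b p h → c * g * (J * b) + p * (J * h) ≡ J * (c * g * b + p * h)
    lem₄ = solve-∀

  padéA padéB : (n U V : ℕ) → ℕ
  padéA = hom k σ τ
  padéB = hom k τ σ

  ev-hom : ∀ s t x w v d n → x ≤ 1 → ev d (2 + k * n) (ser e s t x w v n) ≡ w * (v + d) ^ x * hom k s t n ((v + d) ^ k) (v ^ k)
  ev-hom s t x w v d n x≤1 = begin
    ev d N (ser e s t x w v n)
      ≡⟨ ev-S d N (λ l m j → coef k s t l m * (w * v ^ (k * m)) * pw v (k * l + x) j) n ⟩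
    S (λ l m → ev d N (λ j → coef k s t l m * (w * v ^ (k * m)) * pw v (k * l + x) j)) n
      ≡⟨ S-cong n step ⟩
    S (λ l m → w * u ^ x * (coef k s t l m * ((u ^ k) ^ l * (v ^ k) ^ m))) n
      ≡⟨ S-* (w * u ^ x) (λ l m → coef k s t l m * ((u ^ k) ^ l * (v ^ k) ^ m)) n ⟩
    w * u ^ x * hom k s t n (u ^ k) (v ^ k) ∎
    where
    open ≡-Reasoning
    N u : ℕ
    -- `u A` has degree `k n + 1` in `d`, so this many coefficients make the evaluation exact.
    N = 2 + k * n
    u = v + d
    step : ∀ l m → l + m ≡ n → ev d N (λ j → coef k s t l m * (w * v ^ (k * m)) * pw v (k * l + x) j) ≡
      w * u ^ x * (coef k s t l m * ((u ^ k) ^ l * (v ^ k) ^ m))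
    step l m p = begin
      ev d N (λ j → c * W * pw v (k * l + x) j)  ≡⟨ ev-* d N (c * W) (pw v (k * l + x)) ⟩
      c * W * ev d N (pw v (k * l + x))          ≡⟨ cong (c * W *_) (ev-pw v d (k * l + x) N bound) ⟩
      c * W * u ^ (k * l + x)                    ≡⟨ cong (c * W *_) (trans (^-distribˡ-+-* u (k * l) x) (cong (_* u ^ x) (sym (^-*-assoc u k l)))) ⟩
      c * (w * v ^ (k * m)) * ((u ^ k) ^ l * u ^ x) ≡⟨ cong (λ y → c * (w * y) * ((u ^ k) ^ l * u ^ x)) (sym (^-*-assoc v k m)) ⟩
      c * (w * (v ^ k) ^ m) * ((u ^ k) ^ l * u ^ x) ≡⟨ lem c w ((v ^ k) ^ m) ((u ^ k) ^ l) (u ^ x) ⟩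
      w * u ^ x * (c * ((u ^ k) ^ l * (v ^ k) ^ m)) ∎
      where
      c W : ℕ
      c = coef k s t l m
      W = w * v ^ (k * m)
      lem : ∀ c w a b x → c * (w * a) * (b * x) ≡ w * x * (c * (b * a))
      lem = solve-∀
      bound : k * l + x < N
      bound = s≤s (≤-trans (+-mono-≤ (*-monoʳ-≤ k (≤-trans (m≤m+n l m) (≤-reflexive p))) x≤1) (≤-reflexive (+-comm (k * n) 1)))

  ev-α : ∀ v d n → ev d (2 + k * n) (α e v n) ≡ (v + d) * padéA n ((v + d) ^ k) (v ^ k)
  ev-α v d n = trans (ev-hom σ τ 1 1 v d n ≤-refl) (cong (_* padéA n ((v + d) ^ k) (v ^ k)) (trans (*-identityˡ _) (*-identityʳ (v + d))))

  ev-β : ∀ v d n → ev d (2 + k * n) (β e v n) ≡ v * padéB n ((v + d) ^ k) (v ^ k)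
  ev-β v d n = trans (ev-hom τ σ 0 v v d n z≤n) (cong (_* padéB n ((v + d) ^ k) (v ^ k)) (*-identityʳ v))

  order≡ : ∀ n → order n ≡ 1 + 2 * n
  order≡ zero    = refl
  order≡ (suc n) = trans (cong (λ x → suc (suc x)) (order≡ n)) (lem n)
    where
    lem : ∀ n → 2 + (1 + 2 * n) ≡ 1 + 2 * (1 + n)
    lem = solve-∀

  order-bound : ∀ n → order n < 2 + k * n
  order-bound n = s≤s (≤-trans (≤-reflexive (order≡ n)) (+-monoʳ-≤ 1 (*-monoˡ-≤ n (m≤m+n 2 e))))

  L-pos : ∀ v d n .{{_ : NonZero v}} .{{_ : NonZero d}} → v * padéB n ((v + d) ^ k) (v ^ k) < (v + d) * padéA n ((v + d) ^ k) (v ^ k)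
  L-pos v d n = begin-strict
    v * padéB n ((v + d) ^ k) (v ^ k)       ≡⟨ ev-β v d n ⟨
    ev d (2 + k * n) (β e v n)          <⟨ ev-mono-< d (2 + k * n) (β≤α v n) (order n) (order-bound n) (β<α v n) ⟩
    ev d (2 + k * n) (α e v n)          ≡⟨ ev-α v d n ⟩
    (v + d) * padéA n ((v + d) ^ k) (v ^ k) ∎
    where open ≤-Reasoning

  ev-maj : ∀ v d n J → ev d J (maj v n) ≤ d * ((d * d) * (v + d) ^ e) ^ n
  ev-maj v d zero    zero    = z≤n
  ev-maj v d zero    (suc J) = *-monoʳ-≤ d (≤-one J)
    where
    ≤-one : ∀ J → ev d J one ≤ 1
    ≤-one zero    = z≤n
    ≤-one (suc J) = ≤-reflexive (cong suc (trans (cong (d *_) (ev-zero d J)) (*-zeroʳ d)))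
  ev-maj v d (suc n) J = begin
    ev d J (D (D (Tⁿ v e (maj v n))))          ≤⟨ ev-D-≤ d J _ ⟩
    d * ev d J (D (Tⁿ v e (maj v n)))          ≤⟨ *-monoʳ-≤ d (ev-D-≤ d J _) ⟩
    d * (d * ev d J (Tⁿ v e (maj v n)))        ≤⟨ *-monoʳ-≤ d (*-monoʳ-≤ d (ev-Tⁿ-≤ v d J e (maj v n))) ⟩
    d * (d * ((v + d) ^ e * ev d J (maj v n))) ≤⟨ *-monoʳ-≤ d (*-monoʳ-≤ d (*-monoʳ-≤ ((v + d) ^ e) (ev-maj v d n J))) ⟩
    d * (d * ((v + d) ^ e * (d * ((d * d) * (v + d) ^ e) ^ n))) ≡⟨ lem d ((v + d) ^ e) (((d * d) * (v + d) ^ e) ^ n) ⟩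
    d * ((d * d) * (v + d) ^ e) ^ suc n      ∎
    where
    open ≤-Reasoning
    lem : ∀ d x y → d * (d * (x * (d * y))) ≡ d * ((d * d) * x * y)
    lem = solve-∀

  L-bound : ∀ v d n → den n * ((v + d) * padéA n ((v + d) ^ k) (v ^ k)) ≤
    den n * (v * padéB n ((v + d) ^ k) (v ^ k)) + num n * (d * ((d * d) * (v + d) ^ e) ^ n)
  L-bound v d n = begin
    den n * ((v + d) * padéA n ((v + d) ^ k) (v ^ k))    ≡⟨ cong (den n *_) (ev-α v d n) ⟨
    den n * ev d N (α e v n)                         ≡⟨ ev-* d N (den n) (α e v n) ⟨
    ev d N (λ j → den n * α e v n j)                 ≤⟨ ev-mono d N (α-bound v n) ⟩
    ev d N (λ j → den n * β e v n j + num n * maj v n j) ≡⟨ ev-+ d N (λ j → den n * β e v n j) (λ j → num n * maj v n j) ⟩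
    ev d N (λ j → den n * β e v n j) + ev d N (λ j → num n * maj v n j)
      ≡⟨ cong₂ _+_ (trans (ev-* d N (den n) (β e v n)) (cong (den n *_) (ev-β v d n))) (ev-* d N (num n) (maj v n)) ⟩
    den n * (v * padéB n ((v + d) ^ k) (v ^ k)) + num n * ev d N (maj v n)
      ≤⟨ +-monoʳ-≤ (den n * (v * padéB n ((v + d) ^ k) (v ^ k))) (*-monoʳ-≤ (num n) (ev-maj v d n N)) ⟩
    den n * (v * padéB n ((v + d) ^ k) (v ^ k)) + num n * (d * ((d * d) * (v + d) ^ e) ^ n) ∎
    where
    open ≤-Reasoning
    N : ℕ
    N = 2 + k * n

-- Integrality and monotonicity

^-distribʳ-* : ∀ a b m → (a * b) ^ m ≡ a ^ m * b ^ m
^-distribʳ-* a b zero    = refl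
^-distribʳ-* a b (suc m) = trans (cong (a * b *_) (^-distribʳ-* a b m)) (lem a b (a ^ m) (b ^ m))
  where
  lem : ∀ a b x y → a * b * (x * y) ≡ a * x * (b * y)
  lem = solve-∀

S-∣ : ∀ {d F} n → (∀ l m → l + m ≡ n → d ∣ F l m) → d ∣ S F n
S-∣ zero    dv = dv 0 0 refl
S-∣ (suc n) dv = ∣m∣n⇒∣m+n (dv 0 (suc n) refl) (S-∣ n (λ l m p → dv (suc l) m (cong suc p)))

R-vandermonde : ∀ k n x y → R k n (x + y) ≡ S (λ l m → bin l m * (R k l x * R k m y)) n
R-vandermonde k zero    x y = refl
R-vandermonde k (suc n) x y = begin
  R k (suc n) (x + y)                                ≡⟨ R-suc k n (x + y) ⟩
  R k n (x + y) * (x + y + n * k)                    ≡⟨ trans (cong (_* (x + y + n * k)) (R-vandermonde k n x y)) (*-comm _ (x + y + n * k)) ⟩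
  (x + y + n * k) * S (λ l m → bin l m * (R k l x * R k m y)) n
    ≡⟨ S-* (x + y + n * k) (λ l m → bin l m * (R k l x * R k m y)) n ⟨
  S (λ l m → (x + y + n * k) * (bin l m * (R k l x * R k m y))) n ≡⟨ S-cong n step ⟩
  S (λ l m → bin l m * (R k (suc l) x * R k m y + R k l x * R k (suc m) y)) n
    ≡⟨ bin-pascal-sum (λ l m → R k l x * R k m y) n ⟨
  S (λ l m → bin l m * (R k l x * R k m y)) (suc n)  ∎
  where
  open ≡-Reasoning
  step : ∀ l m → l + m ≡ n → (x + y + n * k) * (bin l m * (R k l x * R k m y)) ≡
    bin l m * (R k (suc l) x * R k m y + R k l x * R k (suc m) y)
  step l m refl = trans (lem k x y l m (bin l m) (R k l x) (R k m y))
    (sym (cong₂ (λ p q → bin l m * (p * R k m y + R k l x * q)) (R-suc k l x) (R-suc k m y)))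
    where
    lem : ∀ k x y l m b p q → (x + y + (l + m) * k) * (b * (p * q)) ≡ b * (p * (x + l * k) * q + p * (q * (y + m * k)))
    lem = solve-∀

R-1-! : ∀ j x → R 1 j (suc x) * x ! ≡ (j + x) !
R-1-! zero    x = *-identityˡ (x !)
R-1-! (suc j) x = begin
  suc x * R 1 j (suc x + 1) * x !   ≡⟨ cong (λ y → suc x * R 1 j y * x !) (+-comm (suc x) 1) ⟩
  suc x * R 1 j (2 + x) * x !       ≡⟨ lem (suc x) (R 1 j (2 + x)) (x !) ⟩
  R 1 j (2 + x) * suc x !           ≡⟨ R-1-! j (suc x) ⟩
  (j + suc x) !                     ≡⟨ cong _! (+-suc j x) ⟩
  (suc j + x) !                     ∎
  where
  open ≡-Reasoning
  lem : ∀ a b c → a * b * c ≡ b * (a * c)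
  lem = solve-∀

!-∣-R-1 : ∀ j x → j ! ∣ R 1 j x
!-∣-R-1 zero    x       = ∣-refl
!-∣-R-1 (suc j) zero    = (suc j !) ∣0
!-∣-R-1 j@(suc _) (suc x) = divides (bin j x) (*-cancelʳ-≡ _ _ (x !) {{x !≢0}}
  (trans (R-1-! j x) (trans (sym (bin-! j x)) (sym (*-assoc (bin j x) (j !) (x !))))))

R-scale : ∀ k j x → R k j (k * x) ≡ k ^ j * R 1 j x
R-scale k zero    x = refl
R-scale k (suc j) x = trans (cong (k * x *_) (trans (cong (R k j) (lem₁ k x)) (R-scale k j (x + 1)))) (lem₂ k x (k ^ j) _)
  where
  lem₁ : ∀ k x → k * x + k ≡ k * (x + 1)
  lem₁ = solve-∀
  lem₂ : ∀ k x p r → k * x * (p * r) ≡ k * p * (x * r)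
  lem₂ = solve-∀

-- modulo j !, x ↦ k ^ (j - 2) * R k j x is additive, by Vandermonde and induction, and R k j (k * x) ≡ 0.
!-∣-R : ∀ k n j → j ≤ n → ∀ x → j ! ∣ k ^ pred j * R k j x
!-∣-R k n       zero          le       x = ∣-refl
!-∣-R k n       (suc zero)    le       x = 1∣ (1 * R k 1 x)
!-∣-R k (suc n) (suc (suc i)) (s≤s le) x = subst (j ! ∣_) (sym (*-assoc k (k ^ i) (R k j x))) multiple
  where
  j : ℕ
  j = suc (suc i)

  f : ℕ → ℕ
  f x = k ^ i * R k j x

  additive : ∀ x y → ∃[ q ] (f (x + y) ≡ f x + f y + q * j !)
  additive x y with S-∣ {j !} {λ l m → k ^ i * (bin (suc l) (suc m) * (R k (suc l) x * R k (suc m) y))} i term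
    where
    term : ∀ l m → l + m ≡ i → j ! ∣ k ^ i * (bin (suc l) (suc m) * (R k (suc l) x * R k (suc m) y))
    term l m refl = subst₂ _∣_ (trans (bin-! (suc l) (suc m)) (cong _! (+-suc (suc l) m)))
      (trans (lem (bin (suc l) (suc m)) (k ^ l) (R k (suc l) x) (k ^ m) (R k (suc m) y))
        (cong (_* (bin (suc l) (suc m) * (R k (suc l) x * R k (suc m) y))) (sym (^-distribˡ-+-* k l m))))
      (*-monoʳ-∣ (bin (suc l) (suc m))
        (*-pres-∣ (!-∣-R k n (suc l) (≤-trans (s≤s (m≤m+n l m)) le) x) (!-∣-R k n (suc m) (≤-trans (s≤s (m≤n+m m l)) le) y)))
      where
      lem : ∀ b p r q s → b * (p * r * (q * s)) ≡ p * q * (b * (r * s))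
      lem = solve-∀
  ... | divides q eq = q , (begin
    k ^ i * R k j (x + y)
      ≡⟨ cong (k ^ i *_) (R-vandermonde k j x y) ⟩
    k ^ i * (1 * (1 * R k j y) + S (λ l m → bin (suc l) m * (R k (suc l) x * R k m y)) (suc i))
      ≡⟨ cong (λ z → k ^ i * (1 * (1 * R k j y) + z)) (S-last (λ l m → bin (suc l) m * (R k (suc l) x * R k m y)) i) ⟩
    k ^ i * (1 * (1 * R k j y) + (M + bin j 0 * (R k j x * 1)))
      ≡⟨ cong (λ b → k ^ i * (1 * (1 * R k j y) + (M + b * (R k j x * 1)))) (bin-zeroʳ j) ⟩
    k ^ i * (1 * (1 * R k j y) + (M + 1 * (R k j x * 1)))
      ≡⟨ lem (k ^ i) (R k j y) M (R k j x) ⟩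
    f x + f y + k ^ i * M
      ≡⟨ cong (f x + f y +_) (trans (sym (S-* (k ^ i) (λ l m → bin (suc l) (suc m) * (R k (suc l) x * R k (suc m) y)) i)) eq) ⟩
    f x + f y + q * j ! ∎)
    where
    open ≡-Reasoning
    M : ℕ
    M = S (λ l m → bin (suc l) (suc m) * (R k (suc l) x * R k (suc m) y)) i
    lem : ∀ p a M b → p * (1 * (1 * a) + (M + 1 * (b * 1))) ≡ p * b + p * a + p * M
    lem = solve-∀

  homogeneous : ∀ N → ∃[ q ] (f (N * x) ≡ N * f x + q * j !)
  homogeneous zero    = 0 , *-zeroʳ (k ^ i)
  homogeneous (suc N) with homogeneous N | additive x (N * x)
  ... | q , eq | q′ , eq′ = q + q′ , trans eq′ (trans (cong (λ y → f x + y + q′ * j !) eq) (lem (f x) N q q′ (j !)))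
    where
    lem : ∀ a N q q′ j → a + (N * a + q * j) + q′ * j ≡ (1 + N) * a + (q + q′) * j
    lem = solve-∀

  multiple : j ! ∣ k * f x
  multiple with homogeneous k
  ... | q , eq = ∣m+n∣m⇒∣n (subst (j ! ∣_) (trans eq (+-comm (k * f x) (q * j !)))
      (∣n⇒∣m*n (k ^ i) (subst (j ! ∣_) (sym (R-scale k j x)) (∣n⇒∣m*n (k ^ j) (!-∣-R-1 j x)))))
    (n∣m*n q)

-- If `l` and `m` are positive, the binomial supplies `(l + m) ! / (l ! m !)` and the two products
-- need only the powers `l - 1` and `m - 1` of `k`, with one `k` to spare. The full exponent `n` is
-- needed at the two ends, where a single product carries the whole factorial.
!-∣-coef : ∀ k s t n l m → l + m ≡ suc n → suc n ! ∣ k ^ n * coef k s t l m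
!-∣-coef k s t n zero    m refl = subst (suc n ! ∣_) (cong (k ^ n *_) (sym (lem (R k m (s + 0)))))
  (!-∣-R k (suc n) (suc n) ≤-refl (s + 0))
  where
  lem : ∀ r → 1 * (r * 1) ≡ r
  lem = solve-∀
!-∣-coef k s t n (suc l) zero    p with trans (sym (+-identityʳ l)) (suc-injective p)
... | refl = subst (suc n ! ∣_) (cong (k ^ n *_) (sym (trans (cong (_* (1 * R k (suc n) (t + 0))) (bin-zeroʳ (suc n))) (lem (R k (suc n) (t + 0))))))
  (!-∣-R k (suc n) (suc n) ≤-refl (t + 0))
  where
  lem : ∀ r → 1 * (1 * r) ≡ r
  lem = solve-∀
!-∣-coef k s t n (suc l) (suc m) p with trans (sym (+-suc l m)) (suc-injective p)
... | refl = subst₂ _∣_ (trans (bin-! (suc l) (suc m)) (cong (λ x → suc x !) (+-suc l m)))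
  (trans (lem k (bin (suc l) (suc m)) (k ^ l) (R k (suc l) y) (k ^ m) (R k (suc m) x))
    (cong (λ z → k * z * (bin (suc l) (suc m) * (R k (suc m) x * R k (suc l) y))) (sym (^-distribˡ-+-* k l m))))
  (∣n⇒∣m*n k (*-monoʳ-∣ (bin (suc l) (suc m))
    (*-pres-∣ (!-∣-R k (suc l) (suc l) ≤-refl y) (!-∣-R k (suc m) (suc m) ≤-refl x))))
  where
  x y : ℕ
  x = s + suc l * k
  y = t + suc m * k
  lem : ∀ k b p r q s → k * (b * (p * r * (q * s))) ≡ k * (p * q) * (b * (s * r))
  lem = solve-∀

!-∣-hom : ∀ k s t n U V → suc n ! ∣ k ^ n * hom k s t (suc n) U V
!-∣-hom k s t n U V = subst (suc n ! ∣_) (S-* (k ^ n) (λ l m → coef k s t l m * (U ^ l * V ^ m)) (suc n))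
  (S-∣ (suc n) (λ l m p → subst (suc n ! ∣_) (*-assoc (k ^ n) (coef k s t l m) (U ^ l * V ^ m))
    (∣m⇒∣m*n (U ^ l * V ^ m) (!-∣-coef k s t n l m p))))

-- Monotonicity of `A / B` in the second argument

rearrange : ∀ {a b c d} → b ≤ a → d ≤ c → a * d + b * c ≤ a * c + b * d
rearrange {b = b} {d = d} b≤a d≤c with m≤n⇒∃[o]m+o≡n b≤a | m≤n⇒∃[o]m+o≡n d≤c
... | i , refl | j , refl = ≤-trans (m≤m+n _ (i * j)) (≤-reflexive (lem b i d j))
  where
  lem : ∀ b i d j → (b + i) * d + b * (d + j) + i * j ≡ (b + i) * (d + j) + b * d
  lem = solve-∀

-- The hypothesis says that `F / G` increases with `m`, so the numerator puts relatively more weight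
-- on high powers of `V`. This is a Chebyshev-type argument: once the terms `l = 0` are split off,
-- the remaining sums are handled by induction and each pair of cross terms by one `rearrange`.
S-ratio-mono : ∀ (F G : ℕ → ℕ → ℕ) {V V′} → V′ ≤ V →
  (∀ l m i → F (l + i) m * G l (m + i) ≤ F l (m + i) * G (l + i) m) → ∀ n →
  S (λ l m → F l m * V′ ^ m) n * S (λ l m → G l m * V ^ m) n ≤ S (λ l m → F l m * V ^ m) n * S (λ l m → G l m * V′ ^ m) n
S-ratio-mono F G {V} {V′} V′≤V tp zero = ≤-refl
S-ratio-mono F G {V} {V′} V′≤V tp (suc n) = begin
  (f * P′ + A′) * (g * P + B)                          ≡⟨ lem₁ f P′ A′ g P B ⟩
  f * g * (P * P′) + A′ * B + (f * P′ * B + g * P * A′) ≤⟨ +-mono-≤ (+-monoʳ-≤ (f * g * (P * P′)) (S-ratio-mono (F ∘ suc) (G ∘ suc) V′≤V (λ l m i → tp (suc l) m i) n)) cross ⟩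
  f * g * (P * P′) + A * B′ + (f * P * B′ + g * P′ * A) ≡⟨ lem₂ f P′ A g P B′ ⟩
  (f * P + A) * (g * P′ + B′)                          ∎
  where
  open ≤-Reasoning
  f g P P′ A A′ B B′ : ℕ
  f = F 0 (suc n)
  g = G 0 (suc n)
  P = V ^ suc n
  P′ = V′ ^ suc n
  A = S (λ l m → F (suc l) m * V ^ m) n
  A′ = S (λ l m → F (suc l) m * V′ ^ m) n
  B = S (λ l m → G (suc l) m * V ^ m) n
  B′ = S (λ l m → G (suc l) m * V′ ^ m) n
  lem₁ : ∀ f P′ A′ g P B → (f * P′ + A′) * (g * P + B) ≡ f * g * (P * P′) + A′ * B + (f * P′ * B + g * P * A′)
  lem₁ = solve-∀
  lem₂ : ∀ f P′ A g P B′ → f * g * (P * P′) + A * B′ + (f * P * B′ + g * P′ * A) ≡ (f * P + A) * (g * P′ + B′)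
  lem₂ = solve-∀
  collect : ∀ x y W W′ → S (λ l m → x * (G (suc l) m * W ^ m) + y * (F (suc l) m * W′ ^ m)) n ≡
    x * S (λ l m → G (suc l) m * W ^ m) n + y * S (λ l m → F (suc l) m * W′ ^ m) n
  collect x y W W′ = trans (S-+ (λ l m → x * (G (suc l) m * W ^ m)) (λ l m → y * (F (suc l) m * W′ ^ m)) n)
    (cong₂ _+_ (S-* x (λ l m → G (suc l) m * W ^ m) n) (S-* y (λ l m → F (suc l) m * W′ ^ m) n))
  cross : f * P′ * B + g * P * A′ ≤ f * P * B′ + g * P′ * A
  cross = begin
    f * P′ * B + g * P * A′ ≡⟨ collect (f * P′) (g * P) V V′ ⟨
    S (λ l m → f * P′ * (G (suc l) m * V ^ m) + g * P * (F (suc l) m * V′ ^ m)) n ≤⟨ S-mono n step ⟩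
    S (λ l m → f * P * (G (suc l) m * V′ ^ m) + g * P′ * (F (suc l) m * V ^ m)) n ≡⟨ collect (f * P) (g * P′) V′ V ⟩
    f * P * B′ + g * P′ * A ∎
    where
    step : ∀ l m → l + m ≡ n → f * P′ * (G (suc l) m * V ^ m) + g * P * (F (suc l) m * V′ ^ m) ≤
      f * P * (G (suc l) m * V′ ^ m) + g * P′ * (F (suc l) m * V ^ m)
    step l m p = begin
      f * P′ * (G (suc l) m * V ^ m) + g * P * (F (suc l) m * V′ ^ m)
        ≡⟨ lem₃ f P′ (G (suc l) m) (V ^ m) g P (F (suc l) m) (V′ ^ m) ⟩
      f * G (suc l) m * (P′ * V ^ m) + F (suc l) m * g * (P * V′ ^ m)
        ≤⟨ rearrange {f * G (suc l) m} {F (suc l) m * g} {P * V′ ^ m} {P′ * V ^ m}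
             (subst (λ x → F (suc l) m * G 0 x ≤ F 0 x * G (suc l) m) index (tp 0 m (suc l))) powers ⟩
      f * G (suc l) m * (P * V′ ^ m) + F (suc l) m * g * (P′ * V ^ m)
        ≡⟨ lem₄ f P (G (suc l) m) (V′ ^ m) g P′ (F (suc l) m) (V ^ m) ⟩
      f * P * (G (suc l) m * V′ ^ m) + g * P′ * (F (suc l) m * V ^ m) ∎
      where
      index : m + suc l ≡ suc n
      index = trans (+-suc m l) (cong suc (trans (+-comm m l) p))
      split : ∀ W → W ^ suc n ≡ W ^ suc l * W ^ m
      split W = trans (cong (W ^_) (sym (cong suc p))) (^-distribˡ-+-* W (suc l) m)
      powers : P′ * V ^ m ≤ P * V′ ^ m
      powers = subst₂ _≤_ (trans (lem₅ (V′ ^ suc l) (V′ ^ m) (V ^ m)) (cong (_* V ^ m) (sym (split V′))))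
                          (trans (lem₆ (V ^ suc l) (V′ ^ m) (V ^ m)) (cong (_* V′ ^ m) (sym (split V))))
                 (*-monoˡ-≤ (V′ ^ m * V ^ m) (^-monoˡ-≤ (suc l) V′≤V))
        where
        lem₅ : ∀ a b c → a * (b * c) ≡ a * b * c
        lem₅ = solve-∀
        lem₆ : ∀ a b c → a * (b * c) ≡ a * c * b
        lem₆ = solve-∀
      lem₃ : ∀ f P′ G v g P F v′ → f * P′ * (G * v) + g * P * (F * v′) ≡ f * G * (P′ * v) + F * g * (P * v′)
      lem₃ = solve-∀
      lem₄ : ∀ f P G v′ g P′ F v → f * G * (P * v′) + F * g * (P′ * v) ≡ f * P * (G * v′) + g * P′ * (F * v)
      lem₄ = solve-∀

-- The binomials are the same on both sides. Splitting `i` factors off the longer products leaves a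
-- common part, times two products of `i` factors that start from `t` on the left and from `s` on
-- the right.
coef-TP : ∀ k {s t} → t ≤ s → ∀ l m i →
  coef k s t (l + i) m * coef k t s l (m + i) ≤ coef k s t l (m + i) * coef k t s (l + i) m
coef-TP k {s} {t} t≤s l m i = begin
  b′ * (r s l′ m * r t m (l + i)) * (b * (r t l (m + i) * r s m′ l))
    ≡⟨ cong₂ (λ x y → b′ * (r s l′ m * x) * (b * (y * r s m′ l))) (split t m l) (split t l m) ⟩
  b′ * (r s l′ m * (r t m i * r t m′ l)) * (b * (r t l i * r t l′ m * r s m′ l))
    ≡⟨ lem₁ b b′ (r s l′ m) (r t m i) (r t m′ l) (r t l i) (r t l′ m) (r s m′ l) ⟩
  r t m i * r t l i * (b * b′ * (r s l′ m * r t m′ l * r t l′ m * r s m′ l))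
    ≤⟨ *-monoˡ-≤ (b * b′ * (r s l′ m * r t m′ l * r t l′ m * r s m′ l)) (*-mono-≤ (mono m) (mono l)) ⟩
  r s m i * r s l i * (b * b′ * (r s l′ m * r t m′ l * r t l′ m * r s m′ l))
    ≡⟨ lem₂ b b′ (r s l′ m) (r s m i) (r t m′ l) (r s l i) (r t l′ m) (r s m′ l) ⟩
  b * (r s l i * r s l′ m * r t m′ l) * (b′ * (r t l′ m * (r s m i * r s m′ l)))
    ≡⟨ cong₂ (λ x y → b * (x * r t m′ l) * (b′ * (r t l′ m * y))) (split s l m) (split s m l) ⟨
  b * (r s l (m + i) * r t m′ l) * (b′ * (r t l′ m * r s m (l + i))) ∎
  where
  open ≤-Reasoning
  l′ m′ b b′ : ℕ
  l′ = l + i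
  m′ = m + i
  b = bin l (m + i)
  b′ = bin (l + i) m
  r : ℕ → ℕ → ℕ → ℕ
  r s l m = R k m (s + l * k)
  mono : ∀ l → r t l i ≤ r s l i
  mono l = R-mono k i (+-monoˡ-≤ (l * k) t≤s)
  split : ∀ s l m → r s l (m + i) ≡ r s l i * r s (l + i) m
  split s l m = trans (cong (λ x → R k x (s + l * k)) (+-comm m i))
    (trans (R-+ k i m (s + l * k)) (cong (λ x → r s l i * R k m x) (lem s l i k)))
    where
    lem : ∀ s l i k → s + l * k + i * k ≡ s + (l + i) * k
    lem = solve-∀
  lem₁ : ∀ b b′ x p y q z w → b′ * (x * (p * y)) * (b * (q * z * w)) ≡ p * q * (b * b′ * (x * y * z * w))
  lem₁ = solve-∀
  lem₂ : ∀ b b′ x p y q z w → p * q * (b * b′ * (x * y * z * w)) ≡ b * (q * x * y) * (b′ * (z * (p * w)))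
  lem₂ = solve-∀

hom-ratio-mono : ∀ k {s t} → t ≤ s → ∀ n U {V V′} → V′ ≤ V →
  hom k s t n U V′ * hom k t s n U V ≤ hom k s t n U V * hom k t s n U V′
hom-ratio-mono k {s} {t} t≤s n U {V} {V′} V′≤V = subst₂ _≤_
  (cong₂ _*_ (assoc s t V′) (assoc t s V)) (cong₂ _*_ (assoc s t V) (assoc t s V′))
  (S-ratio-mono (λ l m → coef k s t l m * U ^ l) (λ l m → coef k t s l m * U ^ l) V′≤V tp n)
  where
  assoc : ∀ s t V → S (λ l m → coef k s t l m * U ^ l * V ^ m) n ≡ hom k s t n U V
  assoc s t V = S-cong n (λ l m _ → *-assoc (coef k s t l m) (U ^ l) (V ^ m))
  tp : ∀ l m i → coef k s t (l + i) m * U ^ (l + i) * (coef k t s l (m + i) * U ^ l) ≤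
    coef k s t l (m + i) * U ^ l * (coef k t s (l + i) m * U ^ (l + i))
  tp l m i = subst₂ _≤_ (lem₁ (coef k s t (l + i) m) (coef k t s l (m + i)) (U ^ (l + i)) (U ^ l))
    (lem₂ (coef k s t l (m + i)) (coef k t s (l + i) m) (U ^ (l + i)) (U ^ l))
    (*-monoˡ-≤ (U ^ (l + i) * U ^ l) (coef-TP k t≤s l m i))
    where
    lem₁ : ∀ a b x y → a * b * (x * y) ≡ a * x * (b * y)
    lem₁ = solve-∀
    lem₂ : ∀ a b x y → a * b * (x * y) ≡ a * y * (b * x)
    lem₂ = solve-∀

hom-scale : ∀ k s t n c U V → hom k s t n (c * U) (c * V) ≡ c ^ n * hom k s t n U V
hom-scale k s t n c U V = trans (S-cong n step) (S-* (c ^ n) (λ l m → coef k s t l m * (U ^ l * V ^ m)) n)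
  where
  step : ∀ l m → l + m ≡ n → coef k s t l m * ((c * U) ^ l * (c * V) ^ m) ≡ c ^ n * (coef k s t l m * (U ^ l * V ^ m))
  step l m refl = trans (cong₂ (λ x y → coef k s t l m * (x * y)) (^-distribʳ-* c U l) (^-distribʳ-* c V m))
    (trans (lem (coef k s t l m) (c ^ l) (U ^ l) (c ^ m) (V ^ m)) (cong (_* (coef k s t l m * (U ^ l * V ^ m))) (sym (^-distribˡ-+-* c l m))))
    where
    lem : ∀ a x u y v → a * (x * u * (y * v)) ≡ x * y * (a * (u * v))
    lem = solve-∀

hom-mono : ∀ k s t n U {V V′} → V′ ≤ V → hom k s t n U V′ ≤ hom k s t n U V
hom-mono k s t n U V′≤V = S-mono n (λ l m _ → *-monoʳ-≤ (coef k s t l m) (*-monoʳ-≤ (U ^ l) (^-monoˡ-≤ m V′≤V)))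

hom-≤ : ∀ k s t n {X Y} → Y ≤ X → hom k s t n X Y ≤ S (coef k s t) n * X ^ n
hom-≤ k s t n {X} {Y} Y≤X = ≤-trans (hom-mono k s t n X Y≤X)
  (≤-reflexive (trans (S-cong n step) (trans (S-* (X ^ n) (coef k s t) n) (*-comm (X ^ n) _))))
  where
  step : ∀ l m → l + m ≡ n → coef k s t l m * (X ^ l * X ^ m) ≡ X ^ n * coef k s t l m
  step l m refl = trans (cong (coef k s t l m *_) (sym (^-distribˡ-+-* X l m))) (*-comm (coef k s t l m) _)

hom-pos : ∀ k s t n {U V} → 0 < s → 0 < V → 0 < hom k s t n U V
hom-pos k s t zero    0<s 0<V = ≤-refl
hom-pos k s t (suc n) {U} {V} 0<s 0<V = ≤-trans
  (≤-trans (*-mono-≤ (R-pos k (suc n) (≤-trans 0<s (m≤m+n s 0))) (*-mono-≤ {1} {1} ≤-refl (m^n>0 V {{>-nonZero 0<V}} (suc n))))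
     (≤-reflexive (cong (_* (1 * V ^ suc n)) (sym (lem (R k (suc n) (s + 0)))))))
  (m≤m+n _ _)
  where
  lem : ∀ r → 1 * (r * 1) ≡ r
  lem = solve-∀

-- The range excluded by the n-th approximant

bernoulli : ∀ p q k → p ^ suc k + suc k * p ^ k * q ≤ (p + q) ^ suc k
bernoulli p q zero    = ≤-reflexive (lem p q)
  where
  lem : ∀ p q → p * 1 + 1 * 1 * q ≡ (p + q) * 1
  lem = solve-∀
bernoulli p q (suc k) = begin
  p ^ (2 + k) + (2 + k) * p ^ (1 + k) * q                    ≤⟨ m≤m+n _ ((1 + k) * p ^ k * q * q) ⟩
  p ^ (2 + k) + (2 + k) * p ^ (1 + k) * q + (1 + k) * p ^ k * q * q ≡⟨ lem p q k (p ^ k) ⟩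
  (p + q) * (p ^ suc k + suc k * p ^ k * q)                  ≤⟨ *-monoʳ-≤ (p + q) (bernoulli p q k) ⟩
  (p + q) ^ suc (suc k)                                      ∎
  where
  open ≤-Reasoning
  lem : ∀ p q k x → p * (p * x) + (2 + k) * (p * x) * q + (1 + k) * x * q * q ≡ (p + q) * (p * x + (1 + k) * x * q)
  lem = solve-∀

<⇒∃-suc : ∀ {m n} → m < n → ∃[ d ] (m + suc d ≡ n)
<⇒∃-suc {m} lt with m≤n⇒∃[o]m+o≡n lt
... | d , eq = d , trans (+-suc m d) eq

private
  -- In the application `f` is `m !`, `K` is `kᵐ⁻¹`, `C / g` is the error constant and `H` is
  -- `(k Y)²ᵐ⁺¹`. The second hypothesis bounds `N` by `δ B / M + C Xₙ q / (g H)`. After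
  -- multiplication by `K` the first part is at most `f / 4`, which is `small`; so the second must
  -- supply at least `3 f / 4`, whence the constants 3 and 4.
  combine : ∀ k f g K N M H δ B Q C Xₙ q W F E .{{_ : NonZero k}} .{{_ : NonZero M}} .{{_ : NonZero f}} .{{_ : NonZero g}} →
    f ≤ K * N → g * M * N * H ≤ g * δ * B * H + C * Xₙ * q * M →
    B ≤ Q * Xₙ → K * Q * (2 * k) ≤ f * W → 2 * (W * Xₙ) * δ ≤ k * M → F * C ≤ E * (f * g) →
    3 * H * F ≤ 4 * (K * Xₙ * q * E)
  combine k f g K N M H δ B Q C Xₙ q W F E f≤ upper B≤ Q≤ δ≤ C≤ = *-cancelˡ-≤ (f * g) {{m*n≢0 f g}} (begin
    f * g * (3 * H * F)                ≡⟨ lem₁ f g H F ⟩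
    F * (3 * (g * H * f))              ≤⟨ *-monoʳ-≤ F main ⟩
    F * (4 * (K * C * Xₙ * q))         ≡⟨ lem₂ F K C Xₙ q ⟩
    4 * (K * Xₙ * q * (F * C))         ≤⟨ *-monoʳ-≤ 4 (*-monoʳ-≤ (K * Xₙ * q) C≤) ⟩
    4 * (K * Xₙ * q * (E * (f * g)))   ≡⟨ lem₃ (K * Xₙ * q) E (f * g) ⟩
    f * g * (4 * (K * Xₙ * q * E))     ∎)
    where
    open ≤-Reasoning
    lem₁ : ∀ f g H F → f * g * (3 * H * F) ≡ F * (3 * (g * H * f))
    lem₁ = solve-∀
    lem₂ : ∀ F K C X q → F * (4 * (K * C * X * q)) ≡ 4 * (K * X * q * (F * C))
    lem₂ = solve-∀
    lem₃ : ∀ a E b → 4 * (a * (E * b)) ≡ b * (4 * (a * E))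
    lem₃ = solve-∀
    small : 4 * (K * δ * B) ≤ f * M
    small = *-cancelˡ-≤ k (begin
      k * (4 * (K * δ * B))            ≤⟨ *-monoʳ-≤ k (*-monoʳ-≤ 4 (*-monoʳ-≤ (K * δ) B≤)) ⟩
      k * (4 * (K * δ * (Q * Xₙ)))     ≡⟨ lem₄ k K δ Q Xₙ ⟩
      2 * δ * Xₙ * (K * Q * (2 * k))   ≤⟨ *-monoʳ-≤ (2 * δ * Xₙ) Q≤ ⟩
      2 * δ * Xₙ * (f * W)             ≡⟨ lem₅ δ Xₙ f W ⟩
      f * (2 * (W * Xₙ) * δ)           ≤⟨ *-monoʳ-≤ f δ≤ ⟩
      f * (k * M)                      ≡⟨ lem₆ f k M ⟩
      k * (f * M)                      ∎)
      where
      lem₄ : ∀ k K δ Q X → k * (4 * (K * δ * (Q * X))) ≡ 2 * δ * X * (K * Q * (2 * k))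
      lem₄ = solve-∀
      lem₅ : ∀ δ X f W → 2 * δ * X * (f * W) ≡ f * (2 * (W * X) * δ)
      lem₅ = solve-∀
      lem₆ : ∀ f k M → f * (k * M) ≡ k * (f * M)
      lem₆ = solve-∀
    main : 3 * (g * H * f) ≤ 4 * (K * C * Xₙ * q)
    main = *-cancelˡ-≤ M (+-cancelˡ-≤ (g * H * (f * M)) _ _ (begin
      g * H * (f * M) + M * (3 * (g * H * f))             ≡⟨ lem₇ g H f M ⟩
      4 * (g * M * H) * f                                 ≤⟨ *-monoʳ-≤ (4 * (g * M * H)) f≤ ⟩
      4 * (g * M * H) * (K * N)                           ≡⟨ lem₈ g M H K N ⟩
      4 * K * (g * M * N * H)                             ≤⟨ *-monoʳ-≤ (4 * K) upper ⟩
      4 * K * (g * δ * B * H + C * Xₙ * q * M)            ≡⟨ lem₉ K g δ B H C Xₙ q M ⟩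
      g * H * (4 * (K * δ * B)) + M * (4 * (K * C * Xₙ * q)) ≤⟨ +-monoˡ-≤ _ (*-monoʳ-≤ (g * H) small) ⟩
      g * H * (f * M) + M * (4 * (K * C * Xₙ * q))        ∎))
      where
      lem₇ : ∀ g H f M → g * H * (f * M) + M * (3 * (g * H * f)) ≡ 4 * (g * M * H) * f
      lem₇ = solve-∀
      lem₈ : ∀ g M H K N → 4 * (g * M * H) * (K * N) ≡ 4 * K * (g * M * N * H)
      lem₈ = solve-∀
      lem₉ : ∀ K g δ B H C X q M → 4 * K * (g * δ * B * H + C * X * q * M) ≡ g * H * (4 * (K * δ * B)) + M * (4 * (K * C * X * q))
      lem₉ = solve-∀

  -- Multiplied by `k`, both sides contain the factor `(k³)ᵐ`; cancelling it exposes the growth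
  -- ratio `4 Y² / (k² X)`.
  unscale : ∀ k Y X q n .{{_ : NonZero k}} → let m = suc n in
    3 * (k * Y * (k * Y * (k * Y)) ^ m) * (4 * k) ^ m ≤ 4 * (k ^ n * X ^ m * q * (k ^ 4) ^ m) →
    3 * (k * k * Y) * (4 * (Y * Y)) ^ m ≤ 4 * q * (k * k * X) ^ m
  unscale k Y X q n le = *-cancelʳ-≤ _ _ ((k * k * k) ^ m) {{m^n≢0 (k * k * k) m {{m*n≢0 (k * k) k {{m*n≢0 k k}}}}}} (begin
    3 * (k * k * Y) * (4 * (Y * Y)) ^ m * (k * k * k) ^ m
      ≡⟨ *-assoc (3 * (k * k * Y)) ((4 * (Y * Y)) ^ m) ((k * k * k) ^ m) ⟩
    3 * (k * k * Y) * ((4 * (Y * Y)) ^ m * (k * k * k) ^ m)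
      ≡⟨ cong (3 * (k * k * Y) *_) (^-distribʳ-* (4 * (Y * Y)) (k * k * k) m) ⟨
    3 * (k * k * Y) * (4 * (Y * Y) * (k * k * k)) ^ m
      ≡⟨ cong (λ z → 3 * (k * k * Y) * z ^ m) (lem₁ k Y) ⟩
    3 * (k * k * Y) * (k * Y * (k * Y) * (4 * k)) ^ m
      ≡⟨ cong (3 * (k * k * Y) *_) (^-distribʳ-* (k * Y * (k * Y)) (4 * k) m) ⟩
    3 * (k * k * Y) * ((k * Y * (k * Y)) ^ m * (4 * k) ^ m)
      ≡⟨ lem₂ k Y ((k * Y * (k * Y)) ^ m) ((4 * k) ^ m) ⟩
    k * (3 * (k * Y * (k * Y * (k * Y)) ^ m) * (4 * k) ^ m)
      ≤⟨ *-monoʳ-≤ k le ⟩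
    k * (4 * (k ^ n * X ^ m * q * (k ^ 4) ^ m))
      ≡⟨ lem₃ k (k ^ n) (X ^ m) q ((k ^ 4) ^ m) ⟩
    4 * q * ((k ^ 4) ^ m * (k ^ m * X ^ m))
      ≡⟨ cong (λ z → 4 * q * ((k ^ 4) ^ m * z)) (^-distribʳ-* k X m) ⟨
    4 * q * ((k ^ 4) ^ m * (k * X) ^ m)
      ≡⟨ cong (4 * q *_) (^-distribʳ-* (k ^ 4) (k * X) m) ⟨
    4 * q * (k ^ 4 * (k * X)) ^ m
      ≡⟨ cong (λ z → 4 * q * z ^ m) (lem₄ k X) ⟩
    4 * q * (k * k * X * (k * k * k)) ^ m
      ≡⟨ cong (4 * q *_) (^-distribʳ-* (k * k * X) (k * k * k) m) ⟩
    4 * q * ((k * k * X) ^ m * (k * k * k) ^ m)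
      ≡⟨ *-assoc (4 * q) ((k * k * X) ^ m) ((k * k * k) ^ m) ⟨
    4 * q * (k * k * X) ^ m * (k * k * k) ^ m ∎)
    where
    open ≤-Reasoning
    m : ℕ
    m = suc n
    lem₁ : ∀ k Y → 4 * (Y * Y) * (k * k * k) ≡ k * Y * (k * Y) * (4 * k)
    lem₁ = solve-∀
    lem₂ : ∀ k Y a b → 3 * (k * k * Y) * (a * b) ≡ k * (3 * (k * Y * a) * b)
    lem₂ = solve-∀
    lem₃ : ∀ k K X q E → k * (4 * (K * X * q * E)) ≡ 4 * q * (E * (k * K * X))
    lem₃ = solve-∀
    lem₄ : ∀ k X → k * (k * (k * (k * 1))) * (k * X) ≡ k * k * X * (k * k * k)
    lem₄ = solve-∀

  k≤power : ∀ k X n .{{_ : NonZero k}} .{{_ : NonZero X}} → k ≤ 2 * (4 * k * k * X) ^ suc n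
  k≤power k X n = begin
    k                                       ≤⟨ m≤m*n k (4 * k * X) {{m*n≢0 (4 * k) X {{m*n≢0 4 k}}}} ⟩
    k * (4 * k * X)                         ≡⟨ lem k X ⟩
    4 * k * k * X                           ≤⟨ m≤m*n (4 * k * k * X) ((4 * k * k * X) ^ n) {{m^n≢0 (4 * k * k * X) n {{m*n≢0 (4 * k * k) X {{m*n≢0 (4 * k) k {{m*n≢0 4 k}}}}}}}} ⟩
    (4 * k * k * X) ^ suc n                 ≤⟨ m≤n*m ((4 * k * k * X) ^ suc n) 2 ⟩
    2 * (4 * k * k * X) ^ suc n             ∎
    where
    open ≤-Reasoning
    lem : ∀ k X → k * (4 * k * X) ≡ 4 * k * k * X
    lem = solve-∀

-- Sizes of the error constant and of the coefficients, and the resulting window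

module _ (e : ℕ) where

  private
    k σ τ : ℕ
    k = 2 + e
    σ = 3 + e
    τ = 1 + e

  -- The error constant is at most `n ! (k³ / 4)ⁿ`, factor by factor: `(σ + n k) (τ + n k)` is
  -- `(k (n + 1))² - 1`, and `4 (n + 1)² ≤ (2 n + 2) (2 n + 3)`.
  num≤den : ∀ n → (4 * k) ^ n * num e n ≤ (k ^ 4) ^ n * (n ! * den e n)
  num≤den zero    = ≤-refl
  num≤den (suc n) = begin
    4 * k * (4 * k) ^ n * (Cₙ e n * num e n)                  ≡⟨ lem₁ (4 * k) ((4 * k) ^ n) (Cₙ e n) (num e n) ⟩
    4 * k * Cₙ e n * ((4 * k) ^ n * num e n)                  ≤⟨ *-mono-≤ step (num≤den n) ⟩
    k ^ 4 * (suc n * J) * ((k ^ 4) ^ n * (n ! * den e n))     ≡⟨ lem₂ (k ^ 4) (suc n) J ((k ^ 4) ^ n) (n !) (den e n) ⟩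
    k ^ 4 * (k ^ 4) ^ n * (suc n * n ! * (J * den e n))       ∎
    where
    open ≤-Reasoning
    J : ℕ
    J = suc (suc (order e n)) * suc (order e n)
    lem₁ : ∀ a b c d → a * b * (c * d) ≡ a * c * (b * d)
    lem₁ = solve-∀
    lem₂ : ∀ a b c d f g → a * (b * c) * (d * (f * g)) ≡ a * d * (b * f * (c * g))
    lem₂ = solve-∀
    product : ∀ e n → (3 + e + n * (2 + e)) * (1 + e + n * (2 + e)) + 1 ≡ (2 + e) * (1 + n) * ((2 + e) * (1 + n))
    product = solve-∀
    lem₃ : ∀ k n → 4 * k * (k * ((1 + n) * (k * (1 + n) * (k * (1 + n))))) + 2 * (k * (k * (k * k))) * (1 + n) * (1 + n)
      ≡ k * (k * (k * (k * 1))) * ((1 + n) * ((2 + (1 + 2 * n)) * (1 + (1 + 2 * n))))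
    lem₃ = solve-∀
    step : 4 * k * Cₙ e n ≤ k ^ 4 * (suc n * J)
    step = begin
      4 * k * (k * (suc n * ((σ + n * k) * (τ + n * k))))
        ≤⟨ *-monoʳ-≤ (4 * k) (*-monoʳ-≤ k (*-monoʳ-≤ (suc n) (≤-trans (m≤m+n ((σ + n * k) * (τ + n * k)) 1) (≤-reflexive (product e n))))) ⟩
      4 * k * (k * (suc n * (k * suc n * (k * suc n))))
        ≤⟨ m≤m+n _ (2 * (k * (k * (k * k))) * suc n * suc n) ⟩
      4 * k * (k * (suc n * (k * suc n * (k * suc n)))) + 2 * (k * (k * (k * k))) * suc n * suc n
        ≡⟨ lem₃ k n ⟩
      k ^ 4 * (suc n * ((2 + (1 + 2 * n)) * (1 + (1 + 2 * n))))
        ≡⟨ cong (λ i → k ^ 4 * (suc n * ((2 + i) * (1 + i)))) (order≡ e n) ⟨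
      k ^ 4 * (suc n * J) ∎

  -- Here `R k n (k + n k)` is `kⁿ (2 n) ! / n !`, and this is the recurrence of the central
  -- binomial coefficients in that guise.
  R-central : ∀ n → R k (suc n) (k + suc n * k) ≡ R k n (k + n * k) * (2 * k * (1 + 2 * n))
  R-central n = *-cancelˡ-≡ _ _ x (begin
    x * R k (suc n) (k + (k + n * k))                  ≡⟨ cong (λ y → x * R k (suc n) y) (+-comm k x) ⟩
    R k (suc (suc n)) x                                ≡⟨ R-suc k (suc n) x ⟩
    R k (suc n) x * (x + suc n * k)                    ≡⟨ cong (_* (x + suc n * k)) (R-suc k n x) ⟩
    R k n x * (x + n * k) * (x + suc n * k)            ≡⟨ lem k n (R k n x) ⟩
    x * (R k n x * (2 * k * (1 + 2 * n)))              ∎)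
    where
    open ≡-Reasoning
    x : ℕ
    x = k + n * k
    lem : ∀ k n r → r * (k + n * k + n * k) * (k + n * k + (1 + n) * k) ≡ (k + n * k) * (r * (2 * k * (1 + 2 * n)))
    lem = solve-∀

  -- In terms of `m = n + 1` this is the estimate `2 C(2 m, m) ≤ 4ᵐ` for central binomial
  -- coefficients, multiplied by `m ! k²ᵐ`.
  coef-sum-≤ : ∀ n → k ^ n * S (coef k τ σ) (suc n) * (2 * k) ≤ suc n ! * (4 * k * k) ^ suc n
  coef-sum-≤ n = subst (λ r → k ^ n * r * (2 * k) ≤ suc n ! * (4 * k * k) ^ suc n)
    (trans (cong (R k (suc n)) (lem₀ e n)) (sym (coef-sum k (suc n) τ σ))) (go n)
    where
    lem₀ : ∀ e n → (2 + e) + (1 + n) * (2 + e) ≡ (1 + e) + (3 + e) + n * (2 + e)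
    lem₀ = solve-∀
    go : ∀ n → k ^ n * R k (suc n) (k + suc n * k) * (2 * k) ≤ suc n ! * (4 * k * k) ^ suc n
    go zero    = ≤-reflexive (lem k)
      where
      lem : ∀ k → 1 * ((k + 1 * k) * 1) * (2 * k) ≡ 1 * (4 * k * k * 1)
      lem = solve-∀
    go (suc n) = begin
      k * k ^ n * R k (2 + n) (k + (2 + n) * k) * (2 * k)   ≡⟨ cong (λ r → k * k ^ n * r * (2 * k)) (R-central (suc n)) ⟩
      k * k ^ n * (r * (2 * k * (1 + 2 * suc n))) * (2 * k) ≡⟨ lem₁ k (k ^ n) r n ⟩
      2 * k * k * (3 + 2 * n) * (k ^ n * r * (2 * k))       ≤⟨ *-mono-≤ (≤-trans (m≤m+n _ (2 * k * k)) (≤-reflexive (lem₂ k n))) (go n) ⟩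
      4 * k * k * (2 + n) * (suc n ! * (4 * k * k) ^ suc n) ≡⟨ lem₃ (4 * k * k) (2 + n) (suc n !) ((4 * k * k) ^ suc n) ⟩
      (2 + n) * suc n ! * (4 * k * k * (4 * k * k) ^ suc n) ∎
      where
      open ≤-Reasoning
      r : ℕ
      r = R k (suc n) (k + suc n * k)
      lem₁ : ∀ k x r n → k * x * (r * (2 * k * (1 + 2 * (1 + n)))) * (2 * k) ≡ 2 * k * k * (3 + 2 * n) * (x * r * (2 * k))
      lem₁ = solve-∀
      lem₂ : ∀ k n → 2 * k * k * (3 + 2 * n) + 2 * k * k ≡ 4 * k * k * (2 + n)
      lem₂ = solve-∀
      lem₃ : ∀ a b c d → a * b * (c * d) ≡ b * c * (a * d)
      lem₃ = solve-∀

  padéA-scale : ∀ n c U V → padéA e n (c * U) (c * V) ≡ c ^ n * padéA e n U V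
  padéA-scale = hom-scale k σ τ
  padéB-scale : ∀ n c U V → padéB e n (c * U) (c * V) ≡ c ^ n * padéB e n U V
  padéB-scale = hom-scale k τ σ

  ratio-mono : ∀ n U {V V′} → V′ ≤ V → padéA e n U V′ * padéB e n U V ≤ padéA e n U V * padéB e n U V′
  ratio-mono = hom-ratio-mono k (m≤n+m τ 2)

  padéB-pos : ∀ n {U V} → 0 < V → 0 < padéB e n U V
  padéB-pos n = hom-pos k τ σ n z<s

  module Window (x y p δ Y : ℕ) (0<y : 0 < y) (0<p : 0 < p) (0<Y : 0 < Y)
    (x^k≡ : x ^ k ≡ suc Y) (p^k≡ : p ^ k + δ ≡ y ^ k * Y) (p<xy : p < x * y) where

    X q M : ℕ
    X = suc Y
    q = x * y
    M = k * p ^ suc e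

    private
      instance
        y≢0 : NonZero y
        y≢0 = >-nonZero 0<y
        p≢0 : NonZero p
        p≢0 = >-nonZero 0<p
        y^k≢0 : NonZero (y ^ k)
        y^k≢0 = m^n≢0 y k
        pᵉ≢0 : NonZero (p ^ suc e)
        pᵉ≢0 = m^n≢0 p (suc e)
        M≢0 : NonZero M
        M≢0 = m*n≢0 k (p ^ suc e)

      q^k≡ : q ^ k ≡ y ^ k * X
      q^k≡ = trans (^-distribʳ-* x y k) (trans (cong (_* y ^ k) x^k≡) (*-comm X (y ^ k)))

      p^k≤ : p ^ k ≤ y ^ k * Y
      p^k≤ = ≤-trans (m≤m+n (p ^ k) δ) (≤-reflexive p^k≡)

    -- At the point `u = q`, `v = p`, the arguments of the forms are `yᵏ X` and `pᵏ`. Since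
    -- `pᵏ ≤ yᵏ Y`, raising the second argument to `yᵏ Y` only increases `A / B`, and then `yᵏ`
    -- scales out.
    p*B<q*A : ∀ n → p * padéB e n X Y < q * padéA e n X Y
    p*B<q*A n with <⇒∃-suc p<xy
    ... | d , p+d≡q = *-cancelˡ-< ((y ^ k) ^ n) _ _ (*-cancelˡ-< B′ _ _ (begin-strict
      B′ * ((y ^ k) ^ n * (p * padéB e n X Y))   ≡⟨ lem₁ B′ ((y ^ k) ^ n) p (padéB e n X Y) ⟩
      p * B′ * ((y ^ k) ^ n * padéB e n X Y)     ≡⟨ cong (p * B′ *_) (padéB-scale n (y ^ k) X Y) ⟨
      p * B′ * padéB e n U V                     <⟨ *-monoˡ-< (padéB e n U V) {{>-nonZero (padéB-pos n 0<V)}} L>0 ⟩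
      q * A′ * padéB e n U V                     ≡⟨ *-assoc q A′ _ ⟩
      q * (A′ * padéB e n U V)                   ≤⟨ *-monoʳ-≤ q (ratio-mono n U p^k≤) ⟩
      q * (padéA e n U V * B′)                   ≡⟨ cong (λ a → q * (a * B′)) (padéA-scale n (y ^ k) X Y) ⟩
      q * ((y ^ k) ^ n * padéA e n X Y * B′)     ≡⟨ lem₂ q ((y ^ k) ^ n) (padéA e n X Y) B′ ⟩
      B′ * ((y ^ k) ^ n * (q * padéA e n X Y))   ∎))
      where
      open ≤-Reasoning
      U V A′ B′ : ℕ
      U = y ^ k * X
      V = y ^ k * Y
      A′ = padéA e n U (p ^ k)
      B′ = padéB e n U (p ^ k)
      0<V : 0 < V
      0<V = *-mono-≤ (m^n>0 y k) 0<Y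
      L>0 : p * B′ < q * A′
      L>0 = subst₂ (λ u U → p * padéB e n U (p ^ k) < u * padéA e n U (p ^ k)) p+d≡q
        (trans (cong (_^ k) p+d≡q) q^k≡) (L-pos e p (suc d) n)
      lem₁ : ∀ b s p B → b * (s * (p * B)) ≡ p * b * (s * B)
      lem₁ = solve-∀
      lem₂ : ∀ q s a b → q * (s * a * b) ≡ b * (s * (q * a))
      lem₂ = solve-∀

    module _ (δ≤M : δ ≤ M) where

      u v s : ℕ
      u = q * M
      v = p * M + δ
      s = (y * M) ^ k

      private
        instance
          s≢0 : NonZero s
          s≢0 = m^n≢0 (y * M) k {{m*n≢0 y M}}

      v≤u : v ≤ u
      v≤u = begin
        p * M + δ ≤⟨ +-monoʳ-≤ (p * M) δ≤M ⟩
        p * M + M ≡⟨ +-comm (p * M) M ⟩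
        suc p * M ≤⟨ *-monoˡ-≤ M p<xy ⟩
        q * M     ∎
        where open ≤-Reasoning

      u^k≡ : u ^ k ≡ s * X
      u^k≡ = trans (cong (_^ k) (lem x y M)) (trans (^-distribʳ-* x (y * M) k) (trans (cong (_* s) x^k≡) (*-comm X s)))
        where
        lem : ∀ x y M → x * y * M ≡ x * (y * M)
        lem = solve-∀

      -- M and v are chosen so that Bernoulli's inequality gives v / u ≥ θ with v / u - p / q = δ / (q M).
      s*Y≤v^k : s * Y ≤ v ^ k
      s*Y≤v^k = begin
        s * Y                             ≡⟨ cong (_* Y) (^-distribʳ-* y M k) ⟩
        y ^ k * M ^ k * Y                 ≡⟨ lem₁ (y ^ k) (M ^ k) Y ⟩
        M ^ k * (y ^ k * Y)               ≡⟨ cong (M ^ k *_) p^k≡ ⟨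
        M ^ k * (p ^ k + δ)               ≡⟨ lem₂ M (M ^ suc e) (p ^ k) δ ⟩
        p ^ k * M ^ k + M * M ^ suc e * δ ≡⟨ cong₂ _+_ (sym (^-distribʳ-* p M k)) (lem₃ k (p ^ suc e) (M ^ suc e) δ) ⟩
        (p * M) ^ k + k * (p ^ suc e * M ^ suc e) * δ ≡⟨ cong (λ z → (p * M) ^ k + k * z * δ) (^-distribʳ-* p M (suc e)) ⟨
        (p * M) ^ k + k * (p * M) ^ suc e * δ         ≤⟨ bernoulli (p * M) δ (suc e) ⟩
        v ^ k                             ∎
        where
        open ≤-Reasoning
        lem₁ : ∀ a b c → a * b * c ≡ b * (a * c)
        lem₁ = solve-∀
        lem₂ : ∀ M m P δ → M * m * (P + δ) ≡ P * (M * m) + M * m * δ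
        lem₂ = solve-∀
        lem₃ : ∀ k a b δ → k * a * b * δ ≡ k * (a * b) * δ
        lem₃ = solve-∀

      0<v : 0 < v
      0<v = ≤-trans (*-mono-≤ 0<p (>-nonZero⁻¹ M)) (m≤m+n (p * M) δ)

      -- In other words `1 - v / u ≤ 1 / (k Y)`. As `v / u` lies above θ, `uᵏ - vᵏ ≤ uᵏ / X`, and
      -- Bernoulli's inequality bounds the left side below by `k vᵏ⁻¹ d`. Multiplying by `u ≥ v` and
      -- using `vᵏ ≥ s Y` with `uᵏ = s X` gives the claim.
      gap-bound : ∀ d → v + d ≡ u → d * (k * Y) ≤ u
      gap-bound d v+d≡u = *-cancelˡ-≤ (u ^ k) {{u^k≢0}} (begin
        u ^ k * (d * (k * Y))             ≡⟨ cong (_* (d * (k * Y))) u^k≡ ⟩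
        s * X * (d * (k * Y))             ≡⟨ lem₁ s X d k Y ⟩
        k * d * X * (s * Y)               ≤⟨ *-monoʳ-≤ (k * d * X) s*Y≤v^k ⟩
        k * d * X * (v * v ^ suc e)       ≤⟨ *-monoʳ-≤ (k * d * X) (*-monoˡ-≤ (v ^ suc e) v≤u) ⟩
        k * d * X * (u * v ^ suc e)       ≡⟨ lem₂ k d X u (v ^ suc e) ⟩
        X * (k * v ^ suc e * d) * u       ≤⟨ *-monoˡ-≤ u Xkd≤ ⟩
        u ^ k * u                         ∎)
        where
        open ≤-Reasoning
        lem₁ : ∀ s X d k Y → s * X * (d * (k * Y)) ≡ k * d * X * (s * Y)
        lem₁ = solve-∀
        lem₂ : ∀ k d X u w → k * d * X * (u * w) ≡ X * (k * w * d) * u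
        lem₂ = solve-∀
        u^k≢0 : NonZero (u ^ k)
        u^k≢0 = m^n≢0 u k {{>-nonZero (≤-trans 0<v v≤u)}}
        Xkd≤ : X * (k * v ^ suc e * d) ≤ u ^ k
        Xkd≤ = +-cancelˡ-≤ (X * v ^ k) _ _ (begin
          X * v ^ k + X * (k * v ^ suc e * d) ≡⟨ *-distribˡ-+ X (v ^ k) _ ⟨
          X * (v ^ k + k * v ^ suc e * d)     ≤⟨ *-monoʳ-≤ X (bernoulli v d (suc e)) ⟩
          X * (v + d) ^ k                     ≡⟨ cong (λ z → X * z ^ k) v+d≡u ⟩
          u ^ k + Y * u ^ k                   ≡⟨ trans (+-comm (u ^ k) _) (cong (λ z → Y * z + u ^ k) u^k≡) ⟩
          Y * (s * X) + u ^ k                 ≡⟨ cong (_+ u ^ k) (lem₃ Y s X) ⟩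
          X * (s * Y) + u ^ k                 ≤⟨ +-monoˡ-≤ (u ^ k) (*-monoʳ-≤ X s*Y≤v^k) ⟩
          X * v ^ k + u ^ k                   ∎)
          where
          lem₃ : ∀ Y s X → Y * (s * X) ≡ X * (s * Y)
          lem₃ = solve-∀

      -- With `A` and `B` taken at `(X , Y)`, `M N = (u A - v B) + δ B`. As `v / u` is above θ,
      -- `A / B ≤ Aᵤ / Bᵤ`, so `u A - v B` is at most `B / Bᵤ` times the linear form at `(u , v)`,
      -- to which `L-bound` applies; finally `B / Bᵤ ≤ 1 / sⁿ`.
      upper : ∀ n N → p * padéB e n X Y + N ≡ q * padéA e n X Y →
        den e n * M * N * (k * Y * (k * Y * (k * Y)) ^ n) ≤
        den e n * δ * padéB e n X Y * (k * Y * (k * Y * (k * Y)) ^ n) + num e n * X ^ n * q * M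
      upper n N N≡ with m≤n⇒∃[o]m+o≡n v≤u
      ... | d , v+d≡u = *-cancelˡ-≤ (s ^ n) {{m^n≢0 s n}} (begin
        s ^ n * (g * M * N * H)                             ≡⟨ lem₁ (s ^ n) (g * M * N) H ⟩
        s ^ n * (g * M * N) * H                             ≤⟨ *-monoˡ-≤ H crude ⟩
        (s ^ n * (g * δ * B) + C * (d * (d * d * u ^ e) ^ n)) * H ≡⟨ *-distribʳ-+ H (s ^ n * (g * δ * B)) _ ⟩
        s ^ n * (g * δ * B) * H + C * (d * (d * d * u ^ e) ^ n) * H ≤⟨ +-mono-≤ (≤-reflexive (*-assoc (s ^ n) _ H)) tail ⟩
        s ^ n * (g * δ * B * H) + s ^ n * (C * X ^ n * q * M) ≡⟨ *-distribˡ-+ (s ^ n) _ _ ⟨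
        s ^ n * (g * δ * B * H + C * X ^ n * q * M)         ∎)
        where
        open ≤-Reasoning
        g C H B A Aᵤ Bᵤ : ℕ
        g = den e n
        C = num e n
        H = k * Y * (k * Y * (k * Y)) ^ n
        A = padéA e n X Y
        B = padéB e n X Y
        Aᵤ = padéA e n (u ^ k) (v ^ k)
        Bᵤ = padéB e n (u ^ k) (v ^ k)
        E : ℕ
        E = C * (d * (d * d * u ^ e) ^ n)
        lem₁ : ∀ a b c → a * (b * c) ≡ a * b * c
        lem₁ = solve-∀
        Bᵤ≢0 : NonZero Bᵤ
        Bᵤ≢0 = >-nonZero (padéB-pos n (m^n>0 v {{>-nonZero 0<v}} k))
        A*Bᵤ≤ : A * Bᵤ ≤ Aᵤ * B
        A*Bᵤ≤ = *-cancelˡ-≤ (s ^ n) {{m^n≢0 s n}} (begin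
          s ^ n * (A * Bᵤ)           ≡⟨ *-assoc (s ^ n) A Bᵤ ⟨
          s ^ n * A * Bᵤ             ≡⟨ cong (_* Bᵤ) (trans (sym (padéA-scale n s X Y)) (cong (λ z → padéA e n z (s * Y)) (sym u^k≡))) ⟩
          padéA e n (u ^ k) (s * Y) * Bᵤ ≤⟨ ratio-mono n (u ^ k) s*Y≤v^k ⟩
          Aᵤ * padéB e n (u ^ k) (s * Y) ≡⟨ cong (Aᵤ *_) (trans (cong (λ z → padéB e n z (s * Y)) u^k≡) (padéB-scale n s X Y)) ⟩
          Aᵤ * (s ^ n * B)           ≡⟨ lem Aᵤ (s ^ n) B ⟩
          s ^ n * (Aᵤ * B)           ∎)
          where
          lem : ∀ a b c → a * (b * c) ≡ b * (a * c)
          lem = solve-∀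
        sB≤Bᵤ : s ^ n * B ≤ Bᵤ
        sB≤Bᵤ = ≤-trans (≤-reflexive (trans (sym (padéB-scale n s X Y)) (cong (λ z → padéB e n z (s * Y)) (sym u^k≡))))
          (hom-mono k τ σ n (u ^ k) s*Y≤v^k)
        L≤ : g * (u * Aᵤ) ≤ g * (v * Bᵤ) + E
        L≤ = subst (λ z → g * (z * padéA e n (z ^ k) (v ^ k)) ≤ g * (v * padéB e n (z ^ k) (v ^ k)) + C * (d * (d * d * z ^ e) ^ n))
          v+d≡u (L-bound e v d n)
        pre : g * M * N * Bᵤ ≤ g * δ * B * Bᵤ + E * B
        pre = +-cancelˡ-≤ (g * (M * (p * B)) * Bᵤ) _ _ (begin
          g * (M * (p * B)) * Bᵤ + g * M * N * Bᵤ ≡⟨ lem₂ g M (p * B) Bᵤ N ⟩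
          g * (M * (p * B + N)) * Bᵤ              ≡⟨ cong (λ z → g * (M * z) * Bᵤ) N≡ ⟩
          g * (M * (q * A)) * Bᵤ                  ≡⟨ lem₃ g M q A Bᵤ ⟩
          g * u * (A * Bᵤ)                        ≤⟨ *-monoʳ-≤ (g * u) A*Bᵤ≤ ⟩
          g * u * (Aᵤ * B)                        ≡⟨ lem₄ g u Aᵤ B ⟩
          g * (u * Aᵤ) * B                        ≤⟨ *-monoˡ-≤ B L≤ ⟩
          (g * (v * Bᵤ) + E) * B                  ≡⟨ lem₅ g p M δ Bᵤ E B ⟩
          g * (M * (p * B)) * Bᵤ + (g * δ * B * Bᵤ + E * B) ∎)
          where
          lem₂ : ∀ g M a b N → g * (M * a) * b + g * M * N * b ≡ g * (M * (a + N)) * b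
          lem₂ = solve-∀
          lem₃ : ∀ g M q A b → g * (M * (q * A)) * b ≡ g * (q * M) * (A * b)
          lem₃ = solve-∀
          lem₄ : ∀ g u a b → g * u * (a * b) ≡ g * (u * a) * b
          lem₄ = solve-∀
          lem₅ : ∀ g p M δ b E B → (g * ((p * M + δ) * b) + E) * B ≡ g * (M * (p * B)) * b + (g * δ * B * b + E * B)
          lem₅ = solve-∀
        crude : s ^ n * (g * M * N) ≤ s ^ n * (g * δ * B) + E
        crude = *-cancelʳ-≤ _ _ Bᵤ {{Bᵤ≢0}} (begin
          s ^ n * (g * M * N) * Bᵤ                ≡⟨ *-assoc (s ^ n) _ Bᵤ ⟩
          s ^ n * (g * M * N * Bᵤ)                ≤⟨ *-monoʳ-≤ (s ^ n) pre ⟩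
          s ^ n * (g * δ * B * Bᵤ + E * B)        ≡⟨ lem₆ (s ^ n) (g * δ * B) Bᵤ E B ⟩
          s ^ n * (g * δ * B) * Bᵤ + E * (s ^ n * B) ≤⟨ +-monoʳ-≤ _ (*-monoʳ-≤ E sB≤Bᵤ) ⟩
          s ^ n * (g * δ * B) * Bᵤ + E * Bᵤ       ≡⟨ *-distribʳ-+ Bᵤ (s ^ n * (g * δ * B)) E ⟨
          (s ^ n * (g * δ * B) + E) * Bᵤ          ∎)
          where
          lem₆ : ∀ s a b E B → s * (a * b + E * B) ≡ s * a * b + E * (s * B)
          lem₆ = solve-∀
        d≤ : d * (k * Y) ≤ u
        d≤ = gap-bound d v+d≡u
        -- The bound `d k Y ≤ u` is used `2 n + 1` times, once for each power of `d`; together with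
        -- `u ^ (e n)` this produces `u ^ (k n + 1)`.
        tail : E * H ≤ s ^ n * (C * X ^ n * q * M)
        tail = begin
          C * (d * (d * d * u ^ e) ^ n) * (k * Y * (k * Y * (k * Y)) ^ n)
            ≡⟨ lem₇ C d ((d * d * u ^ e) ^ n) (k * Y) ((k * Y * (k * Y)) ^ n) ⟩
          C * (d * (k * Y) * ((d * d * u ^ e) ^ n * (k * Y * (k * Y)) ^ n))
            ≡⟨ cong (λ z → C * (d * (k * Y) * z)) (trans (sym (^-distribʳ-* (d * d * u ^ e) (k * Y * (k * Y)) n)) (cong (_^ n) (lem₈ d (u ^ e) (k * Y)))) ⟩
          C * (d * (k * Y) * ((d * (k * Y) * (d * (k * Y) * u ^ e)) ^ n))
            ≤⟨ *-monoʳ-≤ C (*-mono-≤ d≤ (^-monoˡ-≤ n (*-mono-≤ d≤ (*-monoˡ-≤ (u ^ e) d≤)))) ⟩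
          C * (u * (u ^ k) ^ n)
            ≡⟨ cong (λ z → C * (u * z)) (trans (cong (_^ n) u^k≡) (^-distribʳ-* s X n)) ⟩
          C * (q * M * (s ^ n * X ^ n))
            ≡⟨ lem₉ C q M (s ^ n) (X ^ n) ⟩
          s ^ n * (C * X ^ n * q * M) ∎
          where
          lem₇ : ∀ C d a y b → C * (d * a) * (y * b) ≡ C * (d * y * (a * b))
          lem₇ = solve-∀
          lem₈ : ∀ d w y → d * d * w * (y * y) ≡ d * y * (d * y * w)
          lem₈ = solve-∀
          lem₉ : ∀ C q M s X → C * (q * M * (s * X)) ≡ s * (C * X * q * M)
          lem₉ = solve-∀

    den≢0 : ∀ n → NonZero (den e n)
    den≢0 zero    = _
    den≢0 (suc n) = m*n≢0 (suc (suc (order e n)) * suc (order e n)) (den e n) {{_}} {{den≢0 n}}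

    window : ∀ n → 2 * (4 * k * k * X) ^ suc n * δ ≤ k * M →
      3 * (k * k * Y) * (4 * (Y * Y)) ^ suc n ≤ 4 * q * (k * k * X) ^ suc n
    window n δ-small = unscale k Y X q n
      (combine k (m !) (den e m) (k ^ n) N M (k * Y * (k * Y * (k * Y)) ^ m) δ (padéB e m X Y)
        (S (coef k τ σ) m) (num e m) (X ^ m) q ((4 * k * k) ^ m) ((4 * k) ^ m) ((k ^ 4) ^ m)
        {{_}} {{M≢0}} {{m !≢0}} {{den≢0 m}}
        (∣⇒≤ n!∣) (upper δ≤M m N N≡) (hom-≤ k τ σ m (n≤1+n Y)) (coef-sum-≤ n)
        (subst (λ z → 2 * z * δ ≤ k * M) (^-distribʳ-* (4 * k * k) X m) δ-small) (num≤den m))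
      where
      m N : ℕ
      m = suc n
      excess : ∃[ N ] (p * padéB e m X Y + N ≡ q * padéA e m X Y)
      excess = m≤n⇒∃[o]m+o≡n (<⇒≤ (p*B<q*A m))
      N = proj₁ excess
      N≡ : p * padéB e m X Y + N ≡ q * padéA e m X Y
      N≡ = proj₂ excess
      0<N : 0 < N
      0<N = +-cancelˡ-< (p * padéB e m X Y) 0 N (subst₂ _<_ (sym (+-identityʳ _)) (sym N≡) (p*B<q*A m))
      instance
        KN≢0 : NonZero (k ^ n * N)
        KN≢0 = m*n≢0 (k ^ n) N {{m^n≢0 k n}} {{>-nonZero 0<N}}
      n!∣ : m ! ∣ k ^ n * N
      n!∣ = ∣m+n∣m⇒∣n {m !} {p * (k ^ n * padéB e m X Y)}
        (subst (m ! ∣_) (trans (lem₅ q (k ^ n) (padéA e m X Y)) (trans (cong (k ^ n *_) (sym N≡)) (lem₆ (k ^ n) p (padéB e m X Y) N)))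
          (∣n⇒∣m*n q (!-∣-hom k σ τ n X Y)))
        (∣n⇒∣m*n p (!-∣-hom k τ σ n X Y))
        where
        lem₅ : ∀ q K A → q * (K * A) ≡ K * (q * A)
        lem₅ = solve-∀
        lem₆ : ∀ K p B N → K * (p * B + N) ≡ p * (K * B) + K * N
        lem₆ = solve-∀
      δ≤M : δ ≤ M
      δ≤M = *-cancelˡ-≤ k (≤-trans (*-monoˡ-≤ δ (k≤power k X n)) δ-small)

-- Numerical estimates

-- A bound `d / c` for `X / W` reduces a comparison of powers to an inequality between numerals,
-- which is decided by computation.
ratio-power : ∀ n c d A B X W .{{_ : NonZero c}} → c * X ≤ d * W → A * d ^ n ≤ B * c ^ n → A * X ^ n ≤ B * W ^ n
ratio-power n c d A B X W cX≤dW Ad≤Bc = *-cancelˡ-≤ (c ^ n) {{m^n≢0 c n}} (begin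
  c ^ n * (A * X ^ n)  ≡⟨ lem₁ (c ^ n) A (X ^ n) ⟩
  A * (c ^ n * X ^ n)  ≡⟨ cong (A *_) (^-distribʳ-* c X n) ⟨
  A * (c * X) ^ n      ≤⟨ *-monoʳ-≤ A (^-monoˡ-≤ n cX≤dW) ⟩
  A * (d * W) ^ n      ≡⟨ cong (A *_) (^-distribʳ-* d W n) ⟩
  A * (d ^ n * W ^ n)  ≡⟨ *-assoc A (d ^ n) (W ^ n) ⟨
  A * d ^ n * W ^ n    ≤⟨ *-monoˡ-≤ (W ^ n) Ad≤Bc ⟩
  B * c ^ n * W ^ n    ≡⟨ lem₂ B (c ^ n) (W ^ n) ⟩
  c ^ n * (B * W ^ n)  ∎)
  where
  open ≤-Reasoning
  lem₁ : ∀ a b c → a * (b * c) ≡ b * (a * c)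
  lem₁ = solve-∀
  lem₂ : ∀ a b c → a * b * c ≡ b * (a * c)
  lem₂ = solve-∀

shift-ratio : ∀ c i W → c * i ≤ W → c * (i + W) ≤ suc c * W
shift-ratio c i W le = ≤-trans (≤-reflexive (*-distribˡ-+ c i W)) (+-monoˡ-≤ (c * W) le)

-- The threshold `123 = 5³ - 2` is the least `W` that `x ≥ 5` allows; it gives
-- `(2 + W) / W ≤ 61 / 60`.
4XX<9WW : ∀ {W} → 123 ≤ W → 4 * (2 + W) ^ 2 < 9 * W ^ 2
4XX<9WW {W} le = begin-strict
  4 * (2 + W) ^ 2   ≤⟨ ratio-power 2 60 61 4 8 (2 + W) W (shift-ratio 60 2 W (≤-trans (≤ᵇ⇒≤ 120 123 tt) le)) (≤ᵇ⇒≤ (4 * 61 ^ 2) (8 * 60 ^ 2) tt) ⟩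
  8 * W ^ 2         <⟨ *-monoˡ-< (W ^ 2) {{m^n≢0 W 2 {{>-nonZero (≤-trans (s≤s z≤n) le)}}}} (n<1+n 8) ⟩
  9 * W ^ 2         ∎
  where open ≤-Reasoning

8XXX≤9WWW : ∀ {W} → 123 ≤ W → 8 * (2 + W) ^ 3 ≤ 9 * W ^ 3
8XXX≤9WWW {W} le = ratio-power 3 60 61 8 9 (2 + W) W (shift-ratio 60 2 W (≤-trans (≤ᵇ⇒≤ 120 123 tt) le)) (≤ᵇ⇒≤ (8 * 61 ^ 3) (9 * 60 ^ 3) tt)

3XXX≤4YYY : ∀ {Y} → 123 ≤ Y → 3 * (1 + Y) ^ 3 ≤ 4 * Y ^ 3
3XXX≤4YYY {Y} le = ratio-power 3 60 61 3 4 (1 + Y) Y (shift-ratio 60 1 Y (≤-trans (≤ᵇ⇒≤ 60 123 tt) le)) (≤ᵇ⇒≤ (3 * 61 ^ 3) (4 * 60 ^ 3) tt)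

-- The threshold is `215 = 6³ - 1`. At `Y = 124`, that is `x = 5`, the inequality is false.
729XXX≤4YYYY : ∀ {Y} → 215 ≤ Y → 729 * (1 + Y) ^ 3 ≤ 4 * Y ^ 4
729XXX≤4YYYY {Y} le = begin
  729 * (1 + Y) ^ 3 ≤⟨ ratio-power 3 215 216 729 (4 * 215) (1 + Y) Y (shift-ratio 215 1 Y le) (≤ᵇ⇒≤ (729 * 216 ^ 3) (4 * 215 * 215 ^ 3) tt) ⟩
  4 * 215 * Y ^ 3   ≤⟨ *-monoˡ-≤ (Y ^ 3) (*-monoʳ-≤ 4 le) ⟩
  4 * Y * Y ^ 3     ≡⟨ *-assoc 4 Y (Y ^ 3) ⟩
  4 * Y ^ 4         ∎
  where open ≤-Reasoning

k⁴≤3*5^k : ∀ f → (4 + f) ^ 4 ≤ 3 * 5 ^ (4 + f)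
k⁴≤3*5^k zero    = ≤ᵇ⇒≤ (4 ^ 4) (3 * 5 ^ 4) tt
k⁴≤3*5^k (suc f) = begin
  (5 + f) ^ 4             ≡⟨ *-identityˡ ((5 + f) ^ 4) ⟨
  1 * (5 + f) ^ 4         ≤⟨ ratio-power 4 4 5 1 5 (5 + f) (4 + f) (shift-ratio 4 1 (4 + f) (m≤m+n 4 f)) (≤ᵇ⇒≤ (1 * 5 ^ 4) (5 * 4 ^ 4) tt) ⟩
  5 * (4 + f) ^ 4         ≤⟨ *-monoʳ-≤ 5 (k⁴≤3*5^k f) ⟩
  5 * (3 * 5 ^ (4 + f))   ≡⟨ lem (5 ^ (4 + f)) ⟩
  3 * 5 ^ (5 + f)         ∎
  where
  open ≤-Reasoning
  lem : ∀ z → 5 * (3 * z) ≡ 3 * (5 * z)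
  lem = solve-∀

n<2^n : ∀ n → n < 2 ^ n
n<2^n zero    = z<s
n<2^n (suc n) = begin-strict
  suc n          ≤⟨ n<2^n n ⟩
  2 ^ n          <⟨ m<m+n (2 ^ n) (≤-trans (m^n>0 2 n) (m≤m+n (2 ^ n) 0)) ⟩
  2 ^ suc n      ∎
  where open ≤-Reasoning

-- Overlap of the ranges

^-swap : ∀ a m i → (a ^ m) ^ i ≡ (a ^ i) ^ m
^-swap a m i = trans (^-*-assoc a m i) (trans (cong (a ^_) (*-comm m i)) (sym (^-*-assoc a i m)))

-- The second hypothesis is raised to the power `i` and the first to the power `m`. In use, `α / β`
-- is the growth of the end of a range and `γ` that of its start.
power-step : ∀ i m α β γ a b .{{_ : NonZero β}} → β ^ i * γ ≤ α ^ i → a * α ^ m ≤ b * β ^ m → a ^ i * γ ^ m ≤ b ^ i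
power-step i m α β γ a b βγ≤α aα≤bβ = *-cancelʳ-≤ _ _ ((β ^ i) ^ m) {{m^n≢0 (β ^ i) m {{m^n≢0 β i}}}} (begin
  a ^ i * γ ^ m * (β ^ i) ^ m    ≡⟨ *-assoc (a ^ i) (γ ^ m) ((β ^ i) ^ m) ⟩
  a ^ i * (γ ^ m * (β ^ i) ^ m)  ≡⟨ cong (a ^ i *_) (trans (*-comm (γ ^ m) _) (sym (^-distribʳ-* (β ^ i) γ m))) ⟩
  a ^ i * (β ^ i * γ) ^ m        ≤⟨ *-monoʳ-≤ (a ^ i) (^-monoˡ-≤ m βγ≤α) ⟩
  a ^ i * (α ^ i) ^ m            ≡⟨ cong (a ^ i *_) (^-swap α i m) ⟩
  a ^ i * (α ^ m) ^ i            ≡⟨ ^-distribʳ-* a (α ^ m) i ⟨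
  (a * α ^ m) ^ i                ≤⟨ ^-monoˡ-≤ i aα≤bβ ⟩
  (b * β ^ m) ^ i                ≡⟨ ^-distribʳ-* b (β ^ m) i ⟩
  b ^ i * (β ^ m) ^ i            ≡⟨ cong (b ^ i *_) (^-swap β m i) ⟩
  b ^ i * (β ^ i) ^ m            ∎)
  where open ≤-Reasoning

-- Translates a lower bound on `w = yᵏ⁻¹` into the smallness of δ that `window` expects; the link is
-- `pᵏ⁻¹ ≥ w W / x`.
small-error : ∀ k x P δ W .{{_ : NonZero k}} .{{_ : NonZero x}} G w →
  2 * G * x * suc W ≤ k * k * w * W → w * W ≤ x * P → δ ≤ suc W → 2 * G * δ ≤ k * (k * P)
small-error k x P δ W G w star wW≤xP δ≤Y = *-cancelˡ-≤ x (begin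
  x * (2 * G * δ)     ≤⟨ *-monoʳ-≤ x (*-monoʳ-≤ (2 * G) δ≤Y) ⟩
  x * (2 * G * suc W) ≡⟨ lem₁ x G (suc W) ⟩
  2 * G * x * suc W   ≤⟨ star ⟩
  k * k * w * W       ≡⟨ *-assoc (k * k) w W ⟩
  k * k * (w * W)     ≤⟨ *-monoʳ-≤ (k * k) wW≤xP ⟩
  k * k * (x * P)     ≡⟨ lem₂ k x P ⟩
  x * (k * (k * P))   ∎)
  where
  open ≤-Reasoning
  lem₁ : ∀ x G Y → x * (2 * G * Y) ≡ 2 * G * x * Y
  lem₁ = solve-∀
  lem₂ : ∀ k x P → k * k * (x * P) ≡ x * (k * (k * P))
  lem₂ = solve-∀

-- The claim amounts to `8 X x Y ≤ w W`. The gap principle gives `(x y)² ≥ 9 W²`, and with `x³ ≤ X`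
-- this leaves the numerical estimate `8 X³ ≤ 9 W³`.
first-star : ∀ k x y w W .{{_ : NonZero x}} → 3 ≤ k → 123 ≤ W → x * (x * x) ≤ 2 + W → y * y ≤ w → k * W ≤ x * y →
  2 * (4 * k * k * (2 + W)) ^ 1 * x * suc W ≤ k * k * w * W
first-star k x y w W 3≤k 123≤W x³≤X yy≤w kW≤xy = begin
  2 * (4 * k * k * X) ^ 1 * x * Y      ≡⟨ lem₁ k X x Y ⟩
  k * k * (8 * X * x * Y)              ≤⟨ *-monoʳ-≤ (k * k) (*-cancelˡ-≤ (x * x) {{m*n≢0 x x}} main) ⟩
  k * k * (w * W)                      ≡⟨ *-assoc (k * k) w W ⟨
  k * k * w * W                        ∎
  where
  open ≤-Reasoning
  X Y : ℕ
  X = 2 + W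
  Y = suc W
  lem₁ : ∀ k X x Y → 2 * ((4 * k * k * X) * 1) * x * Y ≡ k * k * (8 * X * x * Y)
  lem₁ = solve-∀
  lem₂ : ∀ x X Y → x * x * (8 * X * x * Y) ≡ 8 * (X * (x * (x * x) * Y))
  lem₂ = solve-∀
  lem₃ : ∀ X → X * (X * X) ≡ X ^ 3
  lem₃ X = cong (λ z → X * (X * z)) (sym (*-identityʳ X))
  lem₄ : ∀ W → 9 * (W * (W * (W * 1))) ≡ 3 * W * (3 * W) * W
  lem₄ = solve-∀
  lem₅ : ∀ x y W → x * y * (x * y) * W ≡ x * x * (y * y * W)
  lem₅ = solve-∀
  3W≤xy : 3 * W ≤ x * y
  3W≤xy = ≤-trans (*-monoˡ-≤ W 3≤k) kW≤xy
  main : x * x * (8 * X * x * Y) ≤ x * x * (w * W)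
  main = begin
    x * x * (8 * X * x * Y)     ≡⟨ lem₂ x X Y ⟩
    8 * (X * (x * (x * x) * Y)) ≤⟨ *-monoʳ-≤ 8 (*-monoʳ-≤ X (*-mono-≤ x³≤X (n≤1+n Y))) ⟩
    8 * (X * (X * X))           ≡⟨ cong (8 *_) (lem₃ X) ⟩
    8 * X ^ 3                   ≤⟨ 8XXX≤9WWW 123≤W ⟩
    9 * W ^ 3                   ≡⟨ lem₄ W ⟩
    3 * W * (3 * W) * W         ≤⟨ *-monoˡ-≤ W (*-mono-≤ 3W≤xy 3W≤xy) ⟩
    x * y * (x * y) * W         ≡⟨ lem₅ x y W ⟩
    x * x * (y * y * W)         ≤⟨ *-monoʳ-≤ (x * x) (*-monoˡ-≤ W yy≤w) ⟩
    x * x * (w * W)             ∎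

-- The `i`-th power of the end of one range overtakes the start of the next. Only `i` of the `k - 1`
-- factors `y` profit from the end of the range; the other `r` are bounded below by `x`, and
-- `xʳ xⁱ⁺¹ = X` then balances the powers of `x`.
next-star : ∀ k x y W i r m .{{_ : NonZero x}} → 3 ≤ k → 123 ≤ W → x ≤ y → 2 ≤ i →
  x ^ r * x ^ suc i ≡ 2 + W → (k * k * (2 + W)) ^ i * (4 * k * k * (2 + W)) ≤ (4 * (suc W * suc W)) ^ i →
  3 * (k * k * suc W) * (4 * (suc W * suc W)) ^ m ≤ 4 * (x * y) * (k * k * (2 + W)) ^ m →
  2 * (4 * k * k * (2 + W)) ^ suc m * x * suc W ≤ k * k * (y ^ i * y ^ r) * W
next-star k x y W i r m 3≤k 123≤W x≤y 2≤i x^≡ growth P = begin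
  2 * (4 * k * k * X * G) * x * Y      ≡⟨ lem₁ k X G x Y ⟩
  k * k * (8 * X * x * Y * G)          ≤⟨ *-monoʳ-≤ (k * k) (*-cancelˡ-≤ (x ^ i * x ^ suc i) {{m*n≢0 (x ^ i) (x ^ suc i) {{m^n≢0 x i}} {{m^n≢0 x (suc i)}}}} main) ⟩
  k * k * (y ^ i * y ^ r * W)          ≡⟨ *-assoc (k * k) (y ^ i * y ^ r) W ⟨
  k * k * (y ^ i * y ^ r) * W          ∎
  where
  open ≤-Reasoning
  X Y G : ℕ
  X = 2 + W
  Y = suc W
  G = (4 * k * k * X) ^ m
  instance
    k≢0 : NonZero k
    k≢0 = >-nonZero (≤-trans (s≤s z≤n) 3≤k)
    kkX≢0 : NonZero (k * k * X)
    kkX≢0 = m*n≢0 (k * k) X {{m*n≢0 k k}}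
  lem₁ : ∀ k X G x Y → 2 * (4 * k * k * X * G) * x * Y ≡ k * k * (8 * X * x * Y * G)
  lem₁ = solve-∀
  lem₂ : ∀ a b X x Y G → a * b * (8 * X * x * Y * G) ≡ 8 * (X * Y) * G * (x * a * b)
  lem₂ = solve-∀
  lem₃ : ∀ X Y G → 8 * (X * Y) * G * (X * X) ≡ X * Y * G * (8 * (X * X))
  lem₃ = solve-∀
  lem₄ : ∀ X Y G W → X * Y * G * (18 * (W * W)) + X * Y * G * (18 * (W * W)) ≡ X * Y * G * (36 * (W * W))
  lem₄ = solve-∀
  lem₅ : ∀ X Y G W → X * Y * G * (36 * (Y * W)) ≡ 6 * Y * (6 * Y * 1) * G * W * X
  lem₅ = solve-∀
  lem₆ : ∀ a b u W c → a * b * W * (c * u) ≡ a * u * (b * c * W)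
  lem₆ = solve-∀
  24≤3kk : 24 ≤ 3 * (k * k)
  24≤3kk = ≤-trans (≤ᵇ⇒≤ 24 27 tt) (*-monoʳ-≤ 3 (*-mono-≤ 3≤k 3≤k))
  -- The constant 6 comes from `4 * 6 = 24 ≤ 27 ≤ 3 k²`. Because `i ≥ 2`, its square 36 is available
  -- against `8 X²`.
  sixth : (6 * Y) ^ i * G ≤ (x * y) ^ i
  sixth = *-cancelˡ-≤ (4 ^ i) {{m^n≢0 4 i}} (begin
    4 ^ i * ((6 * Y) ^ i * G)       ≡⟨ *-assoc (4 ^ i) ((6 * Y) ^ i) G ⟨
    4 ^ i * (6 * Y) ^ i * G         ≡⟨ cong (_* G) (^-distribʳ-* 4 (6 * Y) i) ⟨
    (4 * (6 * Y)) ^ i * G           ≤⟨ *-monoˡ-≤ G (^-monoˡ-≤ i 24Y≤) ⟩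
    (3 * (k * k * Y)) ^ i * G       ≤⟨ power-step i m (4 * (Y * Y)) (k * k * X) (4 * k * k * X) (3 * (k * k * Y)) (4 * (x * y)) growth P ⟩
    (4 * (x * y)) ^ i               ≡⟨ ^-distribʳ-* 4 (x * y) i ⟩
    4 ^ i * (x * y) ^ i             ∎)
    where
    24Y≤ : 4 * (6 * Y) ≤ 3 * (k * k * Y)
    24Y≤ = begin
      4 * (6 * Y)        ≡⟨ *-assoc 4 6 Y ⟨
      24 * Y             ≤⟨ *-monoˡ-≤ Y 24≤3kk ⟩
      3 * (k * k) * Y    ≡⟨ *-assoc 3 (k * k) Y ⟩
      3 * (k * k * Y)    ∎
  x^si≤X : x ^ suc i ≤ X
  x^si≤X = ≤-trans (m≤n*m (x ^ suc i) (x ^ r) {{m^n≢0 x r}}) (≤-reflexive x^≡)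
  8XX≤ : 8 * (X * X) ≤ 36 * (Y * W)
  8XX≤ = begin
    8 * (X * X)             ≡⟨ e₁ X ⟩
    2 * (4 * X ^ 2)         ≤⟨ *-monoʳ-≤ 2 (<⇒≤ (4XX<9WW 123≤W)) ⟩
    2 * (9 * W ^ 2)         ≡⟨ e₂ W ⟩
    18 * (W * W)            ≤⟨ *-mono-≤ (≤ᵇ⇒≤ 18 36 tt) (*-monoˡ-≤ W (n≤1+n W)) ⟩
    36 * (Y * W)            ∎
    where
    e₁ : ∀ X → 8 * (X * X) ≡ 2 * (4 * (X * (X * 1)))
    e₁ = solve-∀
    e₂ : ∀ W → 2 * (9 * (W * (W * 1))) ≡ 18 * (W * W)
    e₂ = solve-∀
  main : x ^ i * x ^ suc i * (8 * X * x * Y * G) ≤ x ^ i * x ^ suc i * (y ^ i * y ^ r * W)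
  main = begin
    x ^ i * x ^ suc i * (8 * X * x * Y * G)   ≡⟨ lem₂ (x ^ i) (x ^ suc i) X x Y G ⟩
    8 * (X * Y) * G * (x ^ suc i * x ^ suc i) ≤⟨ *-monoʳ-≤ (8 * (X * Y) * G) (*-mono-≤ x^si≤X x^si≤X) ⟩
    8 * (X * Y) * G * (X * X)                 ≡⟨ lem₃ X Y G ⟩
    X * Y * G * (8 * (X * X))                 ≤⟨ *-monoʳ-≤ (X * Y * G) 8XX≤ ⟩
    X * Y * G * (36 * (Y * W))                ≡⟨ lem₅ X Y G W ⟩
    (6 * Y) ^ 2 * G * W * X                   ≤⟨ *-monoˡ-≤ X (*-monoˡ-≤ W (*-monoˡ-≤ G (^-monoʳ-≤ (6 * Y) 2≤i))) ⟩
    (6 * Y) ^ i * G * W * X                   ≤⟨ *-monoˡ-≤ X (*-monoˡ-≤ W sixth) ⟩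
    (x * y) ^ i * W * X                       ≡⟨ cong₂ (λ a b → a * W * b) (^-distribʳ-* x y i) (sym x^≡) ⟩
    x ^ i * y ^ i * W * (x ^ r * x ^ suc i)   ≤⟨ *-monoʳ-≤ (x ^ i * y ^ i * W) (*-monoˡ-≤ (x ^ suc i) (^-monoˡ-≤ r x≤y)) ⟩
    x ^ i * y ^ i * W * (y ^ r * x ^ suc i)   ≡⟨ lem₆ (x ^ i) (y ^ i) (x ^ suc i) W (y ^ r) ⟩
    x ^ i * x ^ suc i * (y ^ i * y ^ r * W)   ∎

unbounded : ∀ k Y X q .{{_ : NonZero k}} .{{_ : NonZero Y}} .{{_ : NonZero X}} → 2 * (k * k * X) ≤ 4 * (Y * Y) →
  (∀ n → 3 * (k * k * Y) * (4 * (Y * Y)) ^ suc n ≤ 4 * q * (k * k * X) ^ suc n) → ⊥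
unbounded k Y X q ρ P = <-irrefl refl (begin-strict
  4 * q                       <⟨ n<1+n (4 * q) ⟩
  m                           <⟨ n<2^n m ⟩
  2 ^ m                       ≤⟨ m≤n*m (2 ^ m) (3 * (k * k * Y)) {{m*n≢0 3 (k * k * Y) {{_}} {{m*n≢0 (k * k) Y {{m*n≢0 k k}}}}}} ⟩
  3 * (k * k * Y) * 2 ^ m     ≤⟨ *-cancelʳ-≤ _ _ (Z ^ m) {{m^n≢0 Z m {{m*n≢0 (k * k) X {{m*n≢0 k k}}}}}} scaled ⟩
  4 * q                       ∎)
  where
  open ≤-Reasoning
  m Z : ℕ
  m = suc (4 * q)
  Z = k * k * X
  scaled : 3 * (k * k * Y) * 2 ^ m * Z ^ m ≤ 4 * q * Z ^ m
  scaled = begin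
    3 * (k * k * Y) * 2 ^ m * Z ^ m     ≡⟨ *-assoc (3 * (k * k * Y)) (2 ^ m) (Z ^ m) ⟩
    3 * (k * k * Y) * (2 ^ m * Z ^ m)   ≡⟨ cong (3 * (k * k * Y) *_) (^-distribʳ-* 2 Z m) ⟨
    3 * (k * k * Y) * (2 * Z) ^ m       ≤⟨ *-monoʳ-≤ (3 * (k * k * Y)) (^-monoˡ-≤ m ρ) ⟩
    3 * (k * k * Y) * (4 * (Y * Y)) ^ m ≤⟨ P (4 * q) ⟩
    4 * q * Z ^ m                       ∎

-- The first-order gap is k W ≤ 2 x y; it makes the error term x δ negligible and removes the factor 2.
gap : ∀ k x y w δ W .{{_ : NonZero x}} .{{_ : NonZero y}} .{{_ : NonZero w}} → 3 ≤ k → 123 ≤ W → x * (x * x) ≤ 2 + W → y * y ≤ w →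
  δ ≤ suc W → δ ≤ y * w → k * w * W ≤ x * (y * w + δ) → k * W ≤ x * y
gap k x y w δ W 3≤k 123≤W x³≤X yy≤w δ≤Y δ≤yw le = ≤-pred (*-cancelˡ-< w (k * W) (suc (x * y)) (begin-strict
  w * (k * W)              ≡⟨ lem₁ w k W ⟩
  k * w * W                ≤⟨ le ⟩
  x * (y * w + δ)          ≡⟨ lem₂ x y w δ ⟩
  w * (x * y) + x * δ      <⟨ +-monoʳ-< (w * (x * y)) (≤-trans xδ<yy yy≤w) ⟩
  w * (x * y) + w          ≡⟨ lem₃ w (x * y) ⟩
  w * suc (x * y)          ∎))
  where
  open ≤-Reasoning
  X Y : ℕ
  X = 2 + W
  Y = suc W
  lem₁ : ∀ w k W → w * (k * W) ≡ k * w * W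
  lem₁ = solve-∀
  lem₂ : ∀ x y w δ → x * (y * w + δ) ≡ w * (x * y) + x * δ
  lem₂ = solve-∀
  lem₃ : ∀ w q → w * q + w ≡ w * (1 + q)
  lem₃ = solve-∀
  lem₄ : ∀ x δ → x * x * (4 * (x * δ)) ≡ 4 * (x * (x * x) * δ)
  lem₄ = solve-∀
  lem₅ : ∀ X → 4 * (X * X) ≡ 4 * (X * (X * 1))
  lem₅ = solve-∀
  lem₆ : ∀ W → 9 * (W * (W * 1)) ≡ 3 * W * (3 * W)
  lem₆ = solve-∀
  lem₇ : ∀ x y → 2 * (x * y) * (2 * (x * y)) ≡ x * x * (4 * (y * y))
  lem₇ = solve-∀
  lem₈ : ∀ x y w → x * (y * w + y * w) ≡ w * (2 * (x * y))
  lem₈ = solve-∀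
  crude : 3 * W ≤ 2 * (x * y)
  crude = ≤-trans (*-monoˡ-≤ W 3≤k) (*-cancelˡ-≤ w (begin
    w * (k * W)            ≡⟨ lem₁ w k W ⟩
    k * w * W              ≤⟨ le ⟩
    x * (y * w + δ)        ≤⟨ *-monoʳ-≤ x (+-monoʳ-≤ (y * w) δ≤yw) ⟩
    x * (y * w + y * w)    ≡⟨ lem₈ x y w ⟩
    w * (2 * (x * y))      ∎))
  xδ<yy : x * δ < y * y
  xδ<yy = *-cancelˡ-< 4 (x * δ) (y * y) (*-cancelˡ-< (x * x) (4 * (x * δ)) (4 * (y * y)) (begin-strict
    x * x * (4 * (x * δ))    ≡⟨ lem₄ x δ ⟩
    4 * (x * (x * x) * δ)    ≤⟨ *-monoʳ-≤ 4 (*-mono-≤ x³≤X (≤-trans δ≤Y (n≤1+n Y))) ⟩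
    4 * (X * X)              ≡⟨ lem₅ X ⟩
    4 * X ^ 2                <⟨ 4XX<9WW 123≤W ⟩
    9 * W ^ 2                ≡⟨ lem₆ W ⟩
    3 * W * (3 * W)          ≤⟨ *-mono-≤ crude crude ⟩
    2 * (x * y) * (2 * (x * y)) ≡⟨ lem₇ x y ⟩
    x * x * (4 * (y * y))    ∎))

-- Choice of the overlap exponent

growth-cubic : ∀ {Y} → 215 ≤ Y → (3 * 3 * (1 + Y)) ^ 2 * (4 * 3 * 3 * (1 + Y)) ≤ (4 * (Y * Y)) ^ 2
growth-cubic {Y} le = begin
  (9 * (1 + Y)) ^ 2 * (36 * (1 + Y))  ≡⟨ lem₁ (1 + Y) ⟩
  4 * (729 * (1 + Y) ^ 3)             ≤⟨ *-monoʳ-≤ 4 (729XXX≤4YYYY le) ⟩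
  4 * (4 * Y ^ 4)                     ≡⟨ lem₂ Y ⟩
  (4 * (Y * Y)) ^ 2                   ∎
  where
  open ≤-Reasoning
  lem₁ : ∀ X → 9 * X * (9 * X * 1) * (36 * X) ≡ 4 * (729 * (X * (X * (X * 1))))
  lem₁ = solve-∀
  lem₂ : ∀ Y → 4 * (4 * (Y * (Y * (Y * (Y * 1))))) ≡ 4 * (Y * Y) * (4 * (Y * Y) * 1)
  lem₂ = solve-∀

growth-quartic : ∀ k {Y} → 123 ≤ Y → k ^ 4 ≤ 3 * (1 + Y) → (k * k * (1 + Y)) ^ 3 * (4 * k * k * (1 + Y)) ≤ (4 * (Y * Y)) ^ 3
growth-quartic k {Y} le k⁴≤3X = begin
  (k * k * X) ^ 3 * (4 * k * k * X)     ≡⟨ lem₁ k X ⟩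
  4 * (k ^ 4 * k ^ 4 * X ^ 4)           ≤⟨ *-monoʳ-≤ 4 (*-monoˡ-≤ (X ^ 4) (*-mono-≤ k⁴≤3X k⁴≤3X)) ⟩
  4 * (3 * X * (3 * X) * X ^ 4)         ≡⟨ lem₂ X ⟩
  4 * (3 * X ^ 3 * (3 * X ^ 3))         ≤⟨ *-monoʳ-≤ 4 (*-mono-≤ (3XXX≤4YYY le) (3XXX≤4YYY le)) ⟩
  4 * (4 * Y ^ 3 * (4 * Y ^ 3))         ≡⟨ lem₃ Y ⟩
  (4 * (Y * Y)) ^ 3                     ∎
  where
  open ≤-Reasoning
  X : ℕ
  X = 1 + Y
  lem₁ : ∀ k X → k * k * X * (k * k * X * (k * k * X * 1)) * (4 * k * k * X) ≡
    4 * (k * (k * (k * (k * 1))) * (k * (k * (k * (k * 1)))) * (X * (X * (X * (X * 1)))))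
  lem₁ = solve-∀
  lem₂ : ∀ X → 4 * (3 * X * (3 * X) * (X * (X * (X * (X * 1))))) ≡ 4 * (3 * (X * (X * (X * 1))) * (3 * (X * (X * (X * 1)))))
  lem₂ = solve-∀
  lem₃ : ∀ Y → 4 * (4 * (Y * (Y * (Y * 1))) * (4 * (Y * (Y * (Y * 1))))) ≡ 4 * (Y * Y) * (4 * (Y * Y) * (4 * (Y * Y) * 1))
  lem₃ = solve-∀

ratio-cubic : ∀ {Y} → 215 ≤ Y → 2 * (3 * 3 * (1 + Y)) ≤ 4 * (Y * Y)
ratio-cubic {Y} le = begin
  2 * (9 * (1 + Y))   ≤⟨ *-monoʳ-≤ 2 (*-monoʳ-≤ 9 (+-monoˡ-≤ Y (≤-trans (≤ᵇ⇒≤ 1 215 tt) le))) ⟩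
  2 * (9 * (Y + Y))   ≡⟨ lem Y ⟩
  36 * Y              ≤⟨ *-monoˡ-≤ Y (≤-trans (≤ᵇ⇒≤ 36 (4 * 215) tt) (*-monoʳ-≤ 4 le)) ⟩
  4 * Y * Y           ≡⟨ *-assoc 4 Y Y ⟩
  4 * (Y * Y)         ∎
  where
  open ≤-Reasoning
  lem : ∀ Y → 2 * (9 * (Y + Y)) ≡ 36 * Y
  lem = solve-∀

ratio-quartic : ∀ k {Y} → 4 ≤ k → 123 ≤ Y → k ^ 4 ≤ 3 * (1 + Y) → 2 * (k * k * (1 + Y)) ≤ 4 * (Y * Y)
ratio-quartic k {Y} 4≤k le k⁴≤3X = *-cancelˡ-≤ 4 (begin
  4 * (2 * (k * k * X))     ≡⟨ lem₁ (k * k) X ⟩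
  8 * (k * k) * X           ≤⟨ *-monoˡ-≤ X (*-monoˡ-≤ (k * k) (≤-trans (≤ᵇ⇒≤ 8 16 tt) (*-mono-≤ 4≤k 4≤k))) ⟩
  k * k * (k * k) * X       ≡⟨ cong (_* X) (lem₂ k) ⟩
  k ^ 4 * X                 ≤⟨ *-monoˡ-≤ X k⁴≤3X ⟩
  3 * X * X                 ≤⟨ *-mono-≤ (*-monoʳ-≤ 3 X≤2Y) X≤2Y ⟩
  3 * (Y + Y) * (Y + Y)     ≤⟨ m≤m+n _ (4 * (Y * Y)) ⟩
  3 * (Y + Y) * (Y + Y) + 4 * (Y * Y) ≡⟨ lem₃ Y ⟩
  4 * (4 * (Y * Y))         ∎)
  where
  open ≤-Reasoning
  X : ℕ
  X = 1 + Y
  X≤2Y : X ≤ Y + Y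
  X≤2Y = +-monoˡ-≤ Y (≤-trans (≤ᵇ⇒≤ 1 123 tt) le)
  lem₁ : ∀ a X → 4 * (2 * (a * X)) ≡ 8 * a * X
  lem₁ = solve-∀
  lem₂ : ∀ k → k * k * (k * k) ≡ k * (k * (k * (k * 1)))
  lem₂ = solve-∀
  lem₃ : ∀ Y → 3 * (Y + Y) * (Y + Y) + 4 * (Y * Y) ≡ 4 * (4 * (Y * Y))
  lem₃ = solve-∀

-- The exponent `k - 1` of `y` is split as `i + r`. The first inequality makes consecutive ranges
-- overlap, and the second makes their ends at least double, so that they cover everything.
Growth : ℕ → ℕ → Set
Growth k Y = ∃[ i ] ∃[ r ] (suc (i + r) ≡ k × 2 ≤ i ×
  (k * k * suc Y) ^ i * (4 * k * k * suc Y) ≤ (4 * (Y * Y)) ^ i × 2 * (k * k * suc Y) ≤ 4 * (Y * Y))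

-- For `k = 3` the only choice is `i = 2`. For larger `k` the exponent 2 would require
-- `k⁶ X³ ≤ 4 Y⁴`, which fails at `k = 4`, `x = 5`; with `i = 3` the bound `k⁴ ≤ 3 X` is enough.
growth : ∀ f x Y → x ^ (3 + f) ≡ suc Y → 5 ≤ x → (f ≡ 0 → 6 ≤ x) → 123 ≤ Y → Growth (3 + f) Y
growth zero x Y x^≡ 5≤x 6≤x 123≤Y = 2 , 0 , refl , ≤-refl , growth-cubic 215≤Y , ratio-cubic 215≤Y
  where
  215≤Y : 215 ≤ Y
  215≤Y = ≤-pred (≤-trans (^-monoˡ-≤ 3 (6≤x refl)) (≤-reflexive x^≡))
growth (suc f) x Y x^≡ 5≤x 6≤x 123≤Y =
  3 , f , refl , ≤ᵇ⇒≤ 2 3 tt , growth-quartic (4 + f) 123≤Y k⁴≤3X , ratio-quartic (4 + f) (m≤m+n 4 f) 123≤Y k⁴≤3X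
  where
  k⁴≤3X : (4 + f) ^ 4 ≤ 3 * suc Y
  k⁴≤3X = ≤-trans (k⁴≤3*5^k f) (*-monoʳ-≤ 3 (≤-trans (^-monoˡ-≤ (4 + f) 5≤x) (≤-reflexive x^≡)))

no-close-pair : ∀ f x y p δ W → x ^ (3 + f) ≡ 2 + W → p ^ (3 + f) + δ ≡ y ^ (3 + f) * suc W →
  p < x * y → x < y → δ ≤ suc W → 0 < p → 5 ≤ x → (f ≡ 0 → 6 ≤ x) → ⊥
no-close-pair f x y p δ W x^k≡ p^k≡ p<xy x<y δ≤Y 0<p 5≤x 6≤x = absurd (growth f x Y x^k≡ 5≤x 6≤x (≤-trans 123≤W (n≤1+n W)))
  where
  open ≤-Reasoning
  k Y X w P : ℕ
  k = 3 + f
  Y = suc W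
  X = 2 + W
  w = y ^ (2 + f)
  P = p ^ (2 + f)
  0<y : 0 < y
  0<y = ≤-trans (s≤s z≤n) x<y
  instance
    x≢0 : NonZero x
    x≢0 = >-nonZero (≤-trans (s≤s z≤n) 5≤x)
    y≢0 : NonZero y
    y≢0 = >-nonZero 0<y
    w≢0 : NonZero w
    w≢0 = m^n≢0 y (2 + f)
  x³≤X : x * (x * x) ≤ X
  x³≤X = begin
    x * (x * x)          ≤⟨ m≤m*n (x * (x * x)) (x ^ f) {{m^n≢0 x f}} ⟩
    x * (x * x) * x ^ f  ≡⟨ lem x (x ^ f) ⟩
    x ^ k                ≡⟨ x^k≡ ⟩
    X                    ∎
    where
    lem : ∀ x z → x * (x * x) * z ≡ x * (x * (x * z))
    lem = solve-∀
  yy≤w : y * y ≤ w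
  yy≤w = begin
    y * y          ≤⟨ m≤m*n (y * y) (y ^ f) {{m^n≢0 y f}} ⟩
    y * y * y ^ f  ≡⟨ *-assoc y y (y ^ f) ⟩
    w              ∎
  123≤W : 123 ≤ W
  123≤W = ≤-pred (≤-pred (≤-trans (*-mono-≤ 5≤x (*-mono-≤ 5≤x 5≤x)) x³≤X))
  δ≤yw : δ ≤ y * w
  δ≤yw = begin
    δ       ≤⟨ δ≤Y ⟩
    suc W   ≤⟨ n≤1+n (suc W) ⟩
    X       ≡⟨ x^k≡ ⟨
    x ^ k   ≤⟨ ^-monoˡ-≤ k (<⇒≤ x<y) ⟩
    y * w   ∎
  -- A lower bound for `pᵏ⁻¹`: since `δ ≤ yᵏ`, `pᵏ` is at least `yᵏ W`, and one factor `p` is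
  -- replaced by `x y`.
  wW≤xP : w * W ≤ x * P
  wW≤xP = *-cancelˡ-≤ y (+-cancelʳ-≤ δ _ _ (begin
    y * (w * W) + δ        ≤⟨ +-monoʳ-≤ (y * (w * W)) δ≤yw ⟩
    y * (w * W) + y * w    ≡⟨ lem₁ y w W ⟩
    y * w * Y              ≡⟨ p^k≡ ⟨
    p * P + δ              ≤⟨ +-monoˡ-≤ δ (*-monoˡ-≤ P (<⇒≤ p<xy)) ⟩
    x * y * P + δ          ≡⟨ cong (_+ δ) (lem₂ x y P) ⟩
    y * (x * P) + δ        ∎))
    where
    lem₁ : ∀ y w W → y * (w * W) + y * w ≡ y * w * (1 + W)
    lem₁ = solve-∀
    lem₂ : ∀ x y P → x * y * P ≡ y * (x * P)
    lem₂ = solve-∀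
  -- As `p + 1 ≤ x y`, a full Bernoulli increment `k pᵏ⁻¹` fits between `pᵏ` and `(x y)ᵏ`, which
  -- differ by exactly `yᵏ + δ`. This is the source of the gap principle.
  kP≤ : k * P ≤ y * w + δ
  kP≤ = +-cancelˡ-≤ (p ^ k) _ _ (begin
    p ^ k + k * P               ≡⟨ cong (p ^ k +_) (*-identityʳ (k * P)) ⟨
    p ^ k + k * P * 1           ≤⟨ bernoulli p 1 (2 + f) ⟩
    (p + 1) ^ k                 ≤⟨ ^-monoˡ-≤ k (≤-trans (≤-reflexive (+-comm p 1)) p<xy) ⟩
    (x * y) ^ k                 ≡⟨ ^-distribʳ-* x y k ⟩
    x ^ k * y ^ k               ≡⟨ cong (_* y ^ k) x^k≡ ⟩
    X * (y * w)                 ≡⟨ lem₁ W (y * w) ⟩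
    y * w * Y + y * w           ≡⟨ cong (_+ y * w) p^k≡ ⟨
    p ^ k + δ + y * w           ≡⟨ lem₂ (p ^ k) δ (y * w) ⟩
    p ^ k + (y * w + δ)         ∎)
    where
    lem₁ : ∀ W z → (2 + W) * z ≡ z * (1 + W) + z
    lem₁ = solve-∀
    lem₂ : ∀ a b c → a + b + c ≡ a + (c + b)
    lem₂ = solve-∀
  kW≤xy : k * W ≤ x * y
  kW≤xy = gap k x y w δ W (m≤m+n 3 f) 123≤W x³≤X yy≤w δ≤Y δ≤yw (begin
    k * w * W          ≡⟨ *-assoc k w W ⟩
    k * (w * W)        ≤⟨ *-monoʳ-≤ k wW≤xP ⟩
    k * (x * P)        ≡⟨ lem k x P ⟩
    x * (k * P)        ≤⟨ *-monoʳ-≤ x kP≤ ⟩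
    x * (y * w + δ)    ∎)
    where
    lem : ∀ k x P → k * (x * P) ≡ x * (k * P)
    lem = solve-∀
  open Window (suc f) x y p δ Y 0<y 0<p z<s x^k≡ p^k≡ p<xy using (window)
  absurd : Growth k Y → ⊥
  absurd (i , r , eq , 2≤i , grow , ratio) = unbounded k Y X (x * y) ratio bounds
    where
    w≡ : y ^ i * y ^ r ≡ w
    w≡ = trans (sym (^-distribˡ-+-* y i r)) (cong (y ^_) (suc-injective eq))
    x^≡ : x ^ r * x ^ suc i ≡ X
    x^≡ = trans (sym (^-distribˡ-+-* x r (suc i))) (trans (cong (x ^_) (trans (+-comm r (suc i)) eq)) x^k≡)
    -- star n: y lies beyond the start of the (n + 1)-st excluded range; bounds n: hence beyond its end.
    star : ∀ n → 2 * (4 * k * k * X) ^ suc n * x * Y ≤ k * k * w * W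
    bounds : ∀ n → 3 * (k * k * Y) * (4 * (Y * Y)) ^ suc n ≤ 4 * (x * y) * (k * k * X) ^ suc n
    bounds n = window n (small-error k x P δ W ((4 * k * k * X) ^ suc n) w (star n) wW≤xP δ≤Y)
    star zero    = first-star k x y w W (m≤m+n 3 f) 123≤W x³≤X yy≤w kW≤xy
    star (suc n) = subst (λ z → 2 * (4 * k * k * X) ^ suc (suc n) * x * Y ≤ k * k * z * W) w≡
      (next-star k x y W i r (suc n) (m≤m+n 3 f) 123≤W (<⇒≤ x<y) 2≤i x^≡ grow (bounds n))

-- From the triple to the approximation `p / q`

abs-^ : ∀ i n → ℤ.∣ i ℤ.^ n ∣ ≡ ℤ.∣ i ∣ ^ n
abs-^ i zero    = refl
abs-^ i (suc n) = trans (ℤ.abs-* i (i ℤ.^ n)) (cong (ℤ.∣ i ∣ *_) (abs-^ i n))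

-- The absolute value is multiplicative and fixes the right-hand side, so a root of either sign
-- yields a natural one.
kth-root : ∀ {k n} → IsKthPower k n → ∃[ y ] (y ^ k ≡ n)
kth-root {k} (y , eq) = ℤ.∣ y ∣ , trans (sym (abs-^ y k)) (cong ℤ.∣_∣ eq)

^-cancelˡ-< : ∀ k {m n} → m ^ k < n ^ k → m < n
^-cancelˡ-< k lt = ≰⇒> (λ n≤m → <⇒≱ lt (^-monoˡ-≤ k n≤m))

8b+1≢125 : ∀ b → ¬ (8 * b + 1 ≡ 125)
8b+1≢125 b eq with b ≤? 15
... | yes b≤15 = <⇒≢ (≤-<-trans (+-monoˡ-≤ 1 (*-monoʳ-≤ 8 b≤15)) (≤ᵇ⇒≤ 122 125 tt)) eq
... | no  b≰15 = <⇒≢ (<-≤-trans (≤ᵇ⇒≤ 126 129 tt) (+-monoˡ-≤ 1 (*-monoʳ-≤ 8 (≰⇒> b≰15)))) (sym eq)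

-- For k = 3 the ranges overlap only if x ≥ 6; the remaining value x = 5 would force a = 2 and 8 b = 124.
cubic-≥6 : ∀ a b x → 1 < a → a * a < x → a ^ 3 * b + 1 ≡ x ^ 3 → 6 ≤ x
cubic-≥6 a b x 1<a aa<x eq = ≰⇒> λ x≤5 → excluded a x 1<a aa<x eq x≤5
  where
  excluded : ∀ a x → 1 < a → a * a < x → a ^ 3 * b + 1 ≡ x ^ 3 → ¬ (x ≤ 5)
  excluded a x 1<a aa<x eq x≤5 with ≤-antisym x≤5 (≤-trans (s≤s (*-mono-≤ 1<a 1<a)) aa<x) | a ≤? 2
  ... | refl | no  a≰2 = <⇒≱ aa<x (≤-trans (≤ᵇ⇒≤ 5 9 tt) (*-mono-≤ (≰⇒> a≰2) (≰⇒> a≰2)))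
  ... | refl | yes a≤2 with ≤-antisym a≤2 1<a
  ...   | refl = 8b+1≢125 b eq

theorem1p1 : ∀ (k a b c : ℕ) → 3 ≤ k → 1 < a → a < b → b < c → a ^ k < b →
    ¬ (IsKthPower k (a ^ k * b + 1) × IsKthPower k (a ^ k * c + 1) × IsKthPower k (b * c + 1))
theorem1p1 (suc (suc (suc f))) a b c (s≤s (s≤s (s≤s z≤n))) 1<a a<b b<c a^k<b (X , Y , Z)
  with kth-root {3 + f} X | kth-root {3 + f} Y | kth-root {3 + f} Z | <⇒∃-suc a^k<b
... | x , x^k≡ | y , y^k≡ | z , z^k≡ | r , refl =
  no-close-pair f x y p δ W (trans x^k≡ (trans (+-comm (κ * b) 1) (cong suc (sym (suc-pred (κ * b)))))) p^k≡′
    p<xy x<y δ≤Y 0<p (≤-trans (s≤s (*-mono-≤ 1<a 1<a)) aa<x) 6≤x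
  where
  open ≤-Reasoning
  k κ δ p W : ℕ
  k = 3 + f
  κ = a ^ k
  -- Since `b = κ + suc r`, this is `κ (b - κ)`, the difference of `yᵏ Y = (κ c + 1) κ b` and
  -- `pᵏ = κ² (b c + 1)`. The hypothesis `aᵏ < b` makes it positive.
  δ = κ * suc r
  p = a * a * z
  W = pred (κ * b)
  instance
    a≢0 : NonZero a
    a≢0 = >-nonZero (<⇒≤ 1<a)
    κ≢0 : NonZero κ
    κ≢0 = m^n≢0 a k
    b≢0 : NonZero b
    b≢0 = >-nonZero (≤-<-trans z≤n a<b)
    κb≢0 : NonZero (κ * b)
    κb≢0 = m*n≢0 κ b
  p^k≡ : p ^ k + δ ≡ y ^ k * (κ * b)
  p^k≡ = begin-equality
    (a * a * z) ^ k + κ * suc r                  ≡⟨ cong (_+ κ * suc r) (trans (^-distribʳ-* (a * a) z k) (cong₂ _*_ (^-distribʳ-* a a k) z^k≡)) ⟩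
    κ * κ * (b * c + 1) + κ * suc r              ≡⟨ lem κ r c ⟩
    (κ * c + 1) * (κ * b)                        ≡⟨ cong (_* (κ * b)) y^k≡ ⟨
    y ^ k * (κ * b)                              ∎
    where
    lem : ∀ κ r c → κ * κ * ((κ + (1 + r)) * c + 1) + κ * (1 + r) ≡ (κ * c + 1) * (κ * (κ + (1 + r)))
    lem = solve-∀
  p^k≡′ : p ^ k + δ ≡ y ^ k * suc W
  p^k≡′ = trans p^k≡ (cong (y ^ k *_) (sym (suc-pred (κ * b))))
  x<y : x < y
  x<y = ^-cancelˡ-< k (subst₂ _<_ (sym x^k≡) (sym y^k≡) (+-monoˡ-< 1 (*-monoʳ-< κ b<c)))
  p<xy : p < x * y
  p<xy = ^-cancelˡ-< k (begin-strict
    p ^ k                      ≤⟨ m≤m+n (p ^ k) δ ⟩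
    p ^ k + δ                  ≡⟨ p^k≡ ⟩
    y ^ k * (κ * b)            <⟨ *-monoʳ-< (y ^ k) {{m^n≢0 y k {{>-nonZero (≤-<-trans z≤n x<y)}}}} (m<m+n (κ * b) z<s) ⟩
    y ^ k * (κ * b + 1)        ≡⟨ cong (y ^ k *_) x^k≡ ⟨
    y ^ k * x ^ k              ≡⟨ *-comm (y ^ k) (x ^ k) ⟩
    x ^ k * y ^ k              ≡⟨ ^-distribʳ-* x y k ⟨
    (x * y) ^ k                ∎)
  δ≤Y : δ ≤ suc W
  δ≤Y = ≤-trans (*-monoʳ-≤ κ (m≤n+m (suc r) κ)) (≤-reflexive (sym (suc-pred (κ * b))))
  0<z : 0 < z
  0<z = ^-cancelˡ-< k (≤-trans (≤-trans (s≤s z≤n) (m≤n+m 1 (b * c))) (≤-reflexive (sym z^k≡)))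
  0<p : 0 < p
  0<p = *-mono-≤ (*-mono-≤ (<⇒≤ 1<a) (<⇒≤ 1<a)) 0<z
  -- From `κ ≤ b` one gets `κ² ≤ κ b < xᵏ`. With `a ≥ 2` this yields `x ≥ 5`, on which the numerical
  -- estimates rest.
  aa<x : a * a < x
  aa<x = ^-cancelˡ-< k (begin-strict
    (a * a) ^ k     ≡⟨ ^-distribʳ-* a a k ⟩
    κ * κ           ≤⟨ *-monoʳ-≤ κ (m≤m+n κ (suc r)) ⟩
    κ * b           <⟨ m<m+n (κ * b) z<s ⟩
    κ * b + 1       ≡⟨ x^k≡ ⟨
    x ^ k           ∎)
  6≤x : f ≡ 0 → 6 ≤ x
  6≤x refl = cubic-≥6 a b x 1<a aa<x (sym x^k≡)
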